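{- For integers $3\le k\le n$, \[ \mathbb{E}_3(k,n)\le\frac{2k}{3n}\bigl(1+O(1/k)\bigr). \]
   Context: A $k\times n$ Latin rectangle (with $k\le n$ positive integers) is a $k\times n$ matrix on $n$ symbols (the symbol set is $[n]=\{1,\dots,n\}$), each of which occurs at most once in each row and column. A subsquare of order $m$ of a Latin rectangle $L$ is an $m\times m$ submatrix of $L$ (induced by a set of $m$ rows and a set of $m$ columns, not necessarily contiguous) which is itself a Latin square, i.e. contains exactly $m$ distinct symbols. For an integer $2\le m\le n/2$, $\mathbb{E}_m(k,n)$ denotes the expected number of subsquares of order $m$ in a uniformly random $k\times n$ Latin rectangle. Asymptotics are as $n\to\infty$, with $k$ an arbitrary integer function of $n$ (here with $3\le k\le n$); $O(1/k)$ denotes a quantity bounded in absolute value by a constant times $1/k$ for all sufficiently large $n$. -}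

module Defs where

open import Data.Nat.Base as ℕ using (ℕ; zero; suc; NonZero; >-nonZero; _∸_; _%_)
import Data.Nat.Properties as ℕ
open import Data.Nat.DivMod using (m%n<n; m%n%n≡m%n; m<n⇒m%n≡m; [m+n]%n≡m%n; %-distribˡ-+)
open import Data.Integer.Base using (+_)
open import Data.Rational.Base using (ℚ; _/_; _*_; _≤_; ∣_∣)
open import Data.Fin.Base using (Fin; toℕ; fromℕ<; inject≤)
open import Data.Fin.Properties using (_≟_; any?; all?; toℕ<n; toℕ-injective; toℕ-fromℕ<; toℕ-inject≤)
open import Data.Fin.Subset as Subset using (Subset; inside; outside; _∈_)
open import Data.Fin.Subset.Properties using (_∈?_)
open import Data.List.Base using (List; []; _∷_; [_]; length; map; filter; allFin; cartesianProduct; cartesianProductWith)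
open import Data.Nat.ListAction using (sum)
import Data.List.Membership.Propositional as List
open import Data.List.Membership.Propositional.Properties using (∈-cartesianProductWith⁺; ∈-filter⁺; ∈-length; ∈-allFin)
open import Data.List.Relation.Unary.Any using (here)
open import Data.Product.Base using (_×_; _,_; ∃₂)
open import Data.Vec.Base using (Vec; []; _∷_; lookup; tabulate)
open import Data.Vec.Properties using (lookup∘tabulate)
open import Function.Base using (_∘_)
open import Relation.Binary.PropositionalEquality using (_≡_; refl; sym; trans; cong; module ≡-Reasoning)
open import Relation.Nullary.Decidable using (Dec; does; _×-dec_; _→-dec_)

vectors : {A : Set} → List A → (n : ℕ) → List (Vec A n)
vectors xs zero    = [ [] ]
vectors xs (suc n) = cartesianProductWith _∷_ xs (vectors xs n)

Matrix : ℕ → ℕ → Set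
Matrix k n = Vec (Vec (Fin n) n) k

-- The symbol set is Fin n rather than {1,…,n}.
entry : ∀ {k n} → Matrix k n → Fin k → Fin n → Fin n
entry L i j = lookup (lookup L i) j

IsLatin : ∀ {k n} → Matrix k n → Set
IsLatin L = (∀ i j j′ → entry L i j ≡ entry L i j′ → j ≡ j′)
          × (∀ j i i′ → entry L i j ≡ entry L i′ j → i ≡ i′)

isLatin? : ∀ {k n} (L : Matrix k n) → Dec (IsLatin L)
isLatin? L = all? (λ i → all? λ j → all? λ j′ → (entry L i j ≟ entry L i j′) →-dec (j ≟ j′))
       ×-dec all? (λ j → all? λ i → all? λ i′ → (entry L i j ≟ entry L i′ j) →-dec (i ≟ i′))

latinRectangles : (k n : ℕ) → List (Matrix k n)
latinRectangles k n = filter isLatin? (vectors (vectors (allFin n) n) k)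

OccursIn : ∀ {k n} → Matrix k n → Subset k → Subset n → Fin n → Set
OccursIn L R C s = ∃₂ λ i j → i ∈ R × j ∈ C × entry L i j ≡ s

occursIn? : ∀ {k n} (L : Matrix k n) R C s → Dec (OccursIn L R C s)
occursIn? L R C s = any? λ i → any? λ j → (i ∈? R) ×-dec (j ∈? C) ×-dec (entry L i j ≟ s)

symbols : ∀ {k n} → Matrix k n → Subset k → Subset n → Subset n
symbols L R C = tabulate (λ s → does (occursIn? L R C s))

-- A submatrix is given by its row set R and column set C.  Inside a Latin
-- rectangle an m × m submatrix is a Latin square exactly when it has m symbols.
IsSubsquare : ∀ {k n} → ℕ → Matrix k n → Subset k × Subset n → Set
IsSubsquare m L (R , C) =
  Subset.∣ R ∣ ≡ m × Subset.∣ C ∣ ≡ m × Subset.∣ symbols L R C ∣ ≡ m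

isSubsquare? : ∀ {k n} m (L : Matrix k n) RC → Dec (IsSubsquare m L RC)
isSubsquare? m L (R , C) =
  (Subset.∣ R ∣ ℕ.≟ m) ×-dec (Subset.∣ C ∣ ℕ.≟ m) ×-dec (Subset.∣ symbols L R C ∣ ℕ.≟ m)

subsets : (n : ℕ) → List (Subset n)
subsets = vectors (inside ∷ outside ∷ [])

#subsquares : ∀ {k n} → ℕ → Matrix k n → ℕ
#subsquares {k} {n} m L =
  length (filter (isSubsquare? m L) (cartesianProduct (subsets k) (subsets n)))

-- The cyclic rectangle witnesses that the uniform distribution makes sense.
module _ where
  private
    ∈-vectors : ∀ {A : Set} {xs : List A} {n} (v : Vec A n) →
                (∀ i → lookup v i List.∈ xs) → v List.∈ vectors xs n
    ∈-vectors []      _ = here refl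
    ∈-vectors (x ∷ v) p =
      ∈-cartesianProductWith⁺ _∷_ (p Fin.zero) (∈-vectors v (p ∘ Fin.suc))

    +-%-cancel : ∀ d .{{_ : NonZero d}} {a x y} → a ℕ.≤ d → x ℕ.< d → y ℕ.< d →
                 (x ℕ.+ a) % d ≡ (y ℕ.+ a) % d → x ≡ y
    +-%-cancel d {a} {x} {y} a≤d x<d y<d eq =
      trans (sym (undo x x<d)) (trans (cong (λ z → (z ℕ.+ (d ∸ a) % d) % d) eq) (undo y y<d))
      where
      open ≡-Reasoning
      undo : ∀ z → z ℕ.< d → ((z ℕ.+ a) % d ℕ.+ (d ∸ a) % d) % d ≡ z
      undo z z<d = begin
        ((z ℕ.+ a) % d ℕ.+ (d ∸ a) % d) % d ≡⟨ sym (%-distribˡ-+ (z ℕ.+ a) (d ∸ a) d) ⟩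
        (z ℕ.+ a ℕ.+ (d ∸ a)) % d           ≡⟨ cong (_% d) (ℕ.+-assoc z a (d ∸ a)) ⟩
        (z ℕ.+ (a ℕ.+ (d ∸ a))) % d         ≡⟨ cong (λ w → (z ℕ.+ w) % d) (ℕ.m+[n∸m]≡n a≤d) ⟩
        (z ℕ.+ d) % d                       ≡⟨ [m+n]%n≡m%n z d ⟩
        z % d                               ≡⟨ m<n⇒m%n≡m z<d ⟩
        z                                   ∎

    cyc : ∀ {n} → Fin n → Fin n → Fin n
    cyc {suc n} i j = fromℕ< (m%n<n (toℕ i ℕ.+ toℕ j) (suc n))

    cyc-injˡ : ∀ {n} (i i′ j : Fin n) → cyc i j ≡ cyc i′ j → i ≡ i′
    cyc-injˡ {suc n} i i′ j eq = toℕ-injective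
      (+-%-cancel (suc n) (ℕ.<⇒≤ (toℕ<n j)) (toℕ<n i) (toℕ<n i′)
        (trans (sym (toℕ-fromℕ< _)) (trans (cong toℕ eq) (toℕ-fromℕ< _))))

    cyc-comm : ∀ {n} (i j : Fin n) → cyc i j ≡ cyc j i
    cyc-comm {suc n} i j = toℕ-injective
      (trans (toℕ-fromℕ< _) (trans (cong (_% suc n) (ℕ.+-comm (toℕ i) (toℕ j))) (sym (toℕ-fromℕ< _))))

    cyclic : ∀ {k n} → k ℕ.≤ n → Matrix k n
    cyclic k≤n = tabulate λ i → tabulate (cyc (inject≤ i k≤n))

    entry-cyclic : ∀ {k n} (k≤n : k ℕ.≤ n) i j → entry (cyclic k≤n) i j ≡ cyc (inject≤ i k≤n) j
    entry-cyclic k≤n i j =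
      trans (cong (λ r → lookup r j) (lookup∘tabulate _ i)) (lookup∘tabulate _ j)

    cyclic-isLatin : ∀ {k n} (k≤n : k ℕ.≤ n) → IsLatin (cyclic k≤n)
    cyclic-isLatin k≤n = row , col
      where
      row : ∀ i j j′ → _ → j ≡ j′
      row i j j′ eq = cyc-injˡ j j′ (inject≤ i k≤n)
        (trans (cyc-comm j _) (trans (sym (entry-cyclic k≤n i j))
          (trans eq (trans (entry-cyclic k≤n i j′) (cyc-comm _ j′)))))
      col : ∀ j i i′ → _ → i ≡ i′
      col j i i′ eq = toℕ-injective
        (trans (sym (toℕ-inject≤ i k≤n)) (trans (cong toℕ inj) (toℕ-inject≤ i′ k≤n)))
        where
        inj : inject≤ i k≤n ≡ inject≤ i′ k≤n
        inj = cyc-injˡ _ _ j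
          (trans (sym (entry-cyclic k≤n i j)) (trans eq (entry-cyclic k≤n i′ j)))

  latinRectangles-nonEmpty : ∀ {k n} → k ℕ.≤ n → NonZero (length (latinRectangles k n))
  latinRectangles-nonEmpty k≤n = >-nonZero (∈-length (∈-filter⁺ isLatin?
    (∈-vectors (cyclic k≤n) λ i → ∈-vectors (lookup (cyclic k≤n) i) λ j → ∈-allFin _)
    (cyclic-isLatin k≤n)))

𝔼 : (m k n : ℕ) → .(k ℕ.≤ n) → ℚ
𝔼 m k n k≤n = _/_ (+ sum (map (#subsquares m) (latinRectangles k n)))
                  (length (latinRectangles k n))
                  {{latinRectangles-nonEmpty k≤n}}

-- ε(k,n) = O(1/k) as n → ∞, uniformly over 3 ≤ k ≤ n.
IsO[1/k] : (ℕ → ℕ → ℚ) → Set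
IsO[1/k] ε = ∃₂ λ (c : ℚ) (N : ℕ) → ∀ k n .{{_ : NonZero k}} →
  N ℕ.≤ n → 3 ℕ.≤ k → k ℕ.≤ n → ∣ ε k n ∣ ≤ c * (+ 1 / k)

-- A subsquare of order 3 is destroyed by three switches.  A switch exchanges two
-- columns c and d in the rows belonging to some components of the graph in which row x
-- joins its entries in c and d (or exchanges two symbols, with columns as vertices).
-- Two column switches scatter the third column of the subsquare over three columns, with
-- (n − 3)(n − 4) choices for the partners; a 3-cycle of the other two columns survives.
-- A symbol switch then expels one cell of the 3-cycle, with n − 3 choices for the new
-- symbol, and the five remaining cells are determined by one row and two columns.
--
-- A switch must move one row of the pattern without the others.  The components are
-- paths and cycles, so this succeeds after refilling the pattern suitably: for one of
-- three fillings in the first switch and one of two in each of the others.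
-- As a subsquare can be labelled in 18 ways, this injects
-- {subsquares} × 18 (n − 3)²(n − 4) into 3 · 2 · 2 × {rectangles} × k n², whence
-- 𝔼 ≤ 12 k n² / (18 (n − 3)²(n − 4)) = (2k / 3n)(1 + O(1/n)).
module Submission where

open import Defs
open import Data.Nat.Base as ℕ using (ℕ; zero; suc; NonZero; _∸_; s≤s; z≤n)
open import Data.Integer.Base as ℤ using (+_)
open import Data.Product.Base using (_×_; ∃; _,_; proj₁; proj₂)
open import Data.Bool.Base using (Bool; true; false; if_then_else_; not)
open import Data.Fin.Base as Fin using (Fin; zero; suc; inject≤)
import Data.Fin.Properties as Fin
open import Data.Fin.Properties using (_≟_; any?; pigeonhole)
import Data.Fin.Subset as Subset
open Subset using (Subset; ∣_∣)
open import Data.Fin.Subset.Properties using (⊆-antisym)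
import Data.Integer.Properties as ℤ
open import Data.List.Base as List using (List; []; _∷_; _++_; length; map; filter; allFin; cartesianProduct; cartesianProductWith)
import Data.List.Membership.DecPropositional as Membership
open import Data.List.Membership.Propositional using (_∈_; _∉_)
open import Data.List.Membership.Propositional.Properties using (∈-allFin; ∈-filter⁺; ∈-filter⁻; ∈-lookup; ∈-++⁺ˡ; ∈-++⁺ʳ; ∈-++⁻; ∈-∃++; ∈-cartesianProduct⁺; ∈-cartesianProduct⁻; ∈-cartesianProductWith⁺)
open import Data.List.Properties using (length-++; length-map; length-tabulate; length-filter; filter-++)
import Data.List.Relation.Unary.All as All
import Data.List.Relation.Unary.AllPairs as AllPairs
open import Data.List.Relation.Unary.Any using (here; there)
open import Data.List.Relation.Unary.Unique.Propositional using (Unique)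
open import Data.List.Relation.Unary.Unique.Propositional.Properties using (allFin⁺; filter⁺; cartesianProduct⁺; cartesianProductWith⁺)
open import Data.Nat.ListAction using (sum)
import Data.Nat.Properties as ℕ
open import Data.Nat.Tactic.RingSolver using (solve-∀)
import Data.Rational.Properties as ℚ
open import Data.Rational.Unnormalised.Base as ℚᵘ using (ℚᵘ; mkℚᵘ; *≤*)
import Data.Rational.Unnormalised.Properties as ℚᵘ
open import Data.Sum.Base using (_⊎_; inj₁; inj₂; [_,_]′)
open import Data.Vec.Base as Vec using (Vec; tabulate; lookup)
open import Data.Vec.Properties using (lookup∘tabulate; tabulate∘lookup; tabulate-cong; lookup⇒[]=; ∷-injective)
open import Function.Base using (_∘_)
open import Relation.Binary.PropositionalEquality using (_≡_; _≢_; refl; sym; trans; cong; cong₂; subst; subst₂; ≢-sym)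
open import Relation.Nullary using (Dec; yes; no; contradiction)
open import Relation.Nullary.Decidable using (¬?; does; dec-true; dec-false; toWitness; _⊎-dec_)

-- Components of the union of two partial injections

-- A switch cannot move a single row at will: closing up the columns drags along a whole component,
-- which may run through other rows of the pattern. Delete the edges of the pattern rows. The
-- remaining graph does not depend on how the pattern is filled. In a column switch, the entries of
-- the pattern rows in `c` are now ends of paths of one kind and those in `d` ends of the other
-- kind, with at most one end of each kind in a component. A refilling permutes the ends in `c`
-- among the pattern rows and keeps all the rest, so it decides which two ends each pattern row
-- joins; enough fillings are at hand for one of them to keep the chosen row apart. The other
-- obstacle is inversion, since the result of a switch does not show which rows were moved. But a
-- switch keeps the unordered pair of entries in every row, and the moved set is the least one that
-- contains the pair of the chosen row and is closed for the pairs of the rows outside the pattern.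
-- Such a set can be computed from the unordered pairs alone.

_∈?_ : ∀ {k} (x : Fin k) (xs : List (Fin k)) → Dec (x ∈ xs)
x ∈? xs = Membership._∈?_ _≟_ x xs

Inj : ∀ {k n} → (Fin k → Fin n) → Set
Inj f = ∀ {x y} → f x ≡ f y → x ≡ y

module _ {k n : ℕ} where

  -- κ labels the components of the graph on Fin n in which every x ∈ xs is an edge
  -- from v x to w x.  As v and w are injective, the components are paths and cycles:
  -- each has at most one vertex without incoming and at most one without outgoing edge.
  record Components (v w : Fin k → Fin n) (xs : List (Fin k)) : Set where
    field
      κ       : Fin n → Fin n
      edge    : ∀ {x} → x ∈ xs → κ (v x) ≡ κ (w x)
      sink    : ∀ {y z} → (∀ {x} → x ∈ xs → v x ≢ y) → (∀ {x} → x ∈ xs → v x ≢ z) → κ y ≡ κ z → y ≡ z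
      source  : ∀ {y z} → (∀ {x} → x ∈ xs → w x ≢ y) → (∀ {x} → x ∈ xs → w x ≢ z) → κ y ≡ κ z → y ≡ z
      minimal : ∀ {H : Fin n → Bool} → (∀ {x} → x ∈ xs → H (v x) ≡ H (w x)) → ∀ z → H (κ z) ≡ H z

  -- Edges are added one at a time, and the label of `v x` gives way to that of `w x`. Before this,
  -- `v x` is a sink and `w x` a source, each the only one in its component. So no remaining sink
  -- carries the label that disappears, and no remaining source carries the label of `w x`: merging
  -- never brings two sinks or two sources together. The surviving label is a vertex of the merged
  -- component, which preserves `minimal`.
  components : ∀ {v w} → Inj v → Inj w → ∀ {xs} → Unique xs → Components v w xs
  components v-inj w-inj AllPairs.[] = record
    { κ = λ z → z ; edge = λ () ; sink = λ _ _ eq → eq ; source = λ _ _ eq → eq ; minimal = λ _ _ → refl }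
  components {v} {w} v-inj w-inj {x ∷ xs} (x∉ AllPairs.∷ uniq) = record
    { κ = κ′ ; edge = edge′ ; sink = sink′ ; source = source′ ; minimal = minimal′ }
    where
    open Components (components {v} {w} v-inj w-inj uniq)
    κ′ : Fin n → Fin n
    κ′ z with κ z ≟ κ (v x)
    ... | yes _ = κ (w x)
    ... | no  _ = κ z
    cong′ : ∀ {y z} → κ y ≡ κ z → κ′ y ≡ κ′ z
    cong′ {y} {z} eq with κ y ≟ κ (v x) | κ z ≟ κ (v x)
    ... | yes _ | yes _ = refl
    ... | yes p | no ¬q = contradiction (trans (sym eq) p) ¬q
    ... | no ¬p | yes q = contradiction (trans eq q) ¬p
    ... | no _  | no _  = eq
    edge′ : ∀ {y} → y ∈ x ∷ xs → κ′ (v y) ≡ κ′ (w y)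
    edge′ (there y∈) = cong′ (edge y∈)
    edge′ (here refl) with κ (v x) ≟ κ (v x) | κ (w x) ≟ κ (v x)
    ... | yes _ | yes _ = refl
    ... | yes _ | no  _ = refl
    ... | no ¬p | _     = contradiction refl ¬p
    v-free : ∀ {y} → y ∈ xs → v y ≢ v x
    v-free y∈ eq = All.lookup x∉ y∈ (sym (v-inj eq))
    w-free : ∀ {y} → y ∈ xs → w y ≢ w x
    w-free y∈ eq = All.lookup x∉ y∈ (sym (w-inj eq))
    sink′ : ∀ {y z} → (∀ {u} → u ∈ x ∷ xs → v u ≢ y) → (∀ {u} → u ∈ x ∷ xs → v u ≢ z) → κ′ y ≡ κ′ z → y ≡ z
    sink′ {y} {z} fy fz eq with κ y ≟ κ (v x) | κ z ≟ κ (v x)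
    ... | yes p | _     = contradiction (sym (sink (fy ∘ there) v-free p)) (fy (here refl))
    ... | no _  | yes q = contradiction (sym (sink (fz ∘ there) v-free q)) (fz (here refl))
    ... | no _  | no _  = sink (fy ∘ there) (fz ∘ there) eq
    source′ : ∀ {y z} → (∀ {u} → u ∈ x ∷ xs → w u ≢ y) → (∀ {u} → u ∈ x ∷ xs → w u ≢ z) → κ′ y ≡ κ′ z → y ≡ z
    source′ {y} {z} fy fz eq with κ y ≟ κ (v x) | κ z ≟ κ (v x)
    ... | yes p | yes q = source (fy ∘ there) (fz ∘ there) (trans p (sym q))
    ... | yes p | no _  = contradiction (source w-free (fz ∘ there) eq) (fz (here refl))
    ... | no _  | yes q = contradiction (source w-free (fy ∘ there) (sym eq)) (fy (here refl))
    ... | no _  | no _  = source (fy ∘ there) (fz ∘ there) eq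
    minimal′ : ∀ {H : Fin n → Bool} → (∀ {u} → u ∈ x ∷ xs → H (v u) ≡ H (w u)) → ∀ z → H (κ′ z) ≡ H z
    minimal′ {H} closed z with κ z ≟ κ (v x)
    ... | no _  = minimal {H} (closed ∘ there) z
    ... | yes p = trans (min (w x)) (trans (sym (closed (here refl)))
                  (trans (sym (min (v x))) (trans (sym (cong H p)) (min z))))
      where min = minimal {H} (closed ∘ there)

  Closed : (v w : Fin k → Fin n) (inner : List (Fin k)) → (Fin n → Bool) → Set
  Closed v w inner H = ∀ x → x ∉ inner → H (v x) ≡ H (w x)

  -- H is the union of the components of v p and w p.  Its minimality makes it
  -- recoverable after the switch, so that switches are injective.
  record Separation (v w : Fin k → Fin n) (inner : List (Fin k)) (p : Fin k) : Set where
    field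
      H        : Fin n → Bool
      closed   : ∀ x → H (v x) ≡ H (w x)
      inside   : H (v p) ≡ true
      outside  : ∀ q → q ∈ inner → q ≢ p → H (v q) ≡ false
      minimal  : ∀ H′ → Closed v w inner H′ → H′ (v p) ≡ true → H′ (w p) ≡ true →
                 ∀ z → H z ≡ true → H′ z ≡ true

  record Labelling (v w : Fin k → Fin n) (inner : List (Fin k)) : Set where
    field
      κ       : Fin n → Fin n
      edge    : ∀ x → x ∉ inner → κ (v x) ≡ κ (w x)
      sink    : ∀ {p q} → p ∈ inner → q ∈ inner → κ (v p) ≡ κ (v q) → p ≡ q
      source  : ∀ {p q} → p ∈ inner → q ∈ inner → κ (w p) ≡ κ (w q) → p ≡ q
      minimal : ∀ {H} → Closed v w inner H → ∀ z → H (κ z) ≡ H z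

  -- Only the rows outside `inner` act as edges. By injectivity the `v p` with `p ∈ inner` become
  -- sinks and the `w p` sources.
  labelling : ∀ {v w} → Inj v → Inj w → ∀ inner → Labelling v w inner
  labelling {v} {w} v-inj w-inj inner = record
    { κ = C.κ
    ; edge = λ x x∉ → C.edge (∈-filter⁺ out? (∈-allFin x) x∉)
    ; sink = λ p∈ q∈ → v-inj ∘ C.sink (free v v-inj p∈) (free v v-inj q∈)
    ; source = λ p∈ q∈ → w-inj ∘ C.source (free w w-inj p∈) (free w w-inj q∈)
    ; minimal = λ {H} closed → C.minimal {H} (λ x∈ → closed _ (proj₂ (∈-filter⁻ out? {xs = allFin k} x∈))) }
    where
    out? = λ x → ¬? (x ∈? inner)
    module C = Components (components {v} {w} v-inj w-inj (filter⁺ out? (allFin⁺ k)))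
    free : ∀ (u : Fin k → Fin n) → Inj u → ∀ {p} → p ∈ inner → ∀ {x} → x ∈ filter out? (allFin k) → u x ≢ u p
    free u u-inj p∈ x∈ eq = proj₂ (∈-filter⁻ out? {xs = allFin k} x∈) (subst (_∈ inner) (sym (u-inj eq)) p∈)

  -- The rows of `inner` are no edges for `κ`, so closedness there must come from elsewhere: row `p`
  -- has both ends inside `H` by definition, and `apart` puts both ends of every other inner row
  -- outside.
  separation : ∀ {v w inner p} (κ : Fin n → Fin n) → p ∈ inner →
               (∀ x → x ∉ inner → κ (v x) ≡ κ (w x)) →
               (∀ {H} → Closed v w inner H → ∀ z → H (κ z) ≡ H z) →
               (∀ q → q ∈ inner → q ≢ p →
                 (κ (v q) ≢ κ (v p) × κ (v q) ≢ κ (w p)) × (κ (w q) ≢ κ (v p) × κ (w q) ≢ κ (w p))) →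
               Separation v w inner p
  separation {v} {w} {inner} {p} κ p∈ edge min apart = record
    { H = H ; closed = closed ; inside = in₁ ; outside = λ q q∈ q≢ → out (proj₁ (apart q q∈ q≢))
    ; minimal = minimal }
    where
    dec = λ z → (κ z ≟ κ (v p)) ⊎-dec (κ z ≟ κ (w p))
    H : Fin n → Bool
    H z = does (dec z)
    in₁ : H (v p) ≡ true
    in₁ = dec-true (dec (v p)) (inj₁ refl)
    in₂ : H (w p) ≡ true
    in₂ = dec-true (dec (w p)) (inj₂ refl)
    out : ∀ {z} → κ z ≢ κ (v p) × κ z ≢ κ (w p) → H z ≡ false
    out {z} (a , b) = dec-false (dec z) [ a , b ]′
    closed : ∀ x → H (v x) ≡ H (w x)
    closed x with x ∈? inner | x ≟ p
    ... | no x∉ | _        = cong (λ y → does ((y ≟ κ (v p)) ⊎-dec (y ≟ κ (w p)))) (edge x x∉)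
    ... | yes _ | yes refl = trans in₁ (sym in₂)
    ... | yes x∈ | no x≢p  = trans (out (proj₁ (apart x x∈ x≢p))) (sym (out (proj₂ (apart x x∈ x≢p))))
    minimal : ∀ H′ → Closed v w inner H′ → H′ (v p) ≡ true → H′ (w p) ≡ true →
              ∀ z → H z ≡ true → H′ z ≡ true
    minimal H′ cl Hv Hw z Hz with κ z ≟ κ (v p) | κ z ≟ κ (w p)
    ... | yes e | _     = trans (sym (min {H′} cl z)) (trans (cong H′ e) (trans (min {H′} cl (v p)) Hv))
    ... | no _  | yes e = trans (sym (min {H′} cl z)) (trans (cong H′ e) (trans (min {H′} cl (w p)) Hw))
    minimal H′ cl Hv Hw z () | no _ | no _

-- Transpositions and 3-cycles

rotate : ∀ {n} (a b c : Fin n) → Fin n → Fin n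
rotate a b c z with z ≟ a
... | yes _ = b
... | no  _ with z ≟ b
...   | yes _ = c
...   | no  _ with z ≟ c
...     | yes _ = a
...     | no  _ = z

swap : ∀ {n} (a b : Fin n) → Fin n → Fin n
swap a b z with z ≟ a
... | yes _ = b
... | no  _ with z ≟ b
...   | yes _ = a
...   | no  _ = z

rotate^ : ∀ {n} (a b c : Fin n) → Fin 3 → Fin n → Fin n
rotate^ a b c zero             z = z
rotate^ a b c (suc zero)       z = rotate a b c z
rotate^ a b c (suc (suc zero)) z = rotate a b c (rotate a b c z)

swap-1 : ∀ {n} (a b : Fin n) → swap a b a ≡ b
swap-1 a b with a ≟ a
... | yes _ = refl
... | no ¬p = contradiction refl ¬p

swap-2 : ∀ {n} (a b : Fin n) → swap a b b ≡ a
swap-2 a b with b ≟ a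
... | yes refl = refl
... | no _ with b ≟ b
...   | yes _ = refl
...   | no ¬p = contradiction refl ¬p

swap-other : ∀ {n} {a b z : Fin n} → z ≢ a → z ≢ b → swap a b z ≡ z
swap-other {a = a} {b} {z} z≢a z≢b with z ≟ a
... | yes p = contradiction p z≢a
... | no _ with z ≟ b
...   | yes p = contradiction p z≢b
...   | no _ = refl

swap-involutive : ∀ {n} (a b z : Fin n) → swap a b (swap a b z) ≡ z
swap-involutive a b z with z ≟ a
... | yes refl = swap-2 z b
... | no z≢a with z ≟ b
...   | yes refl = swap-1 a z
...   | no z≢b = swap-other z≢a z≢b

swap-inj : ∀ {n} (a b : Fin n) → Inj (swap a b)
swap-inj a b eq = trans (sym (swap-involutive a b _)) (trans (cong (swap a b) eq) (swap-involutive a b _))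

module _ {n : ℕ} {a b c : Fin n} (a≢b : a ≢ b) (a≢c : a ≢ c) (b≢c : b ≢ c) where
  rotate-1 : rotate a b c a ≡ b
  rotate-1 with a ≟ a
  ... | yes _ = refl
  ... | no ¬p = contradiction refl ¬p

  rotate-2 : rotate a b c b ≡ c
  rotate-2 with b ≟ a
  ... | yes p = contradiction (sym p) a≢b
  ... | no _ with b ≟ b
  ...   | yes _ = refl
  ...   | no ¬p = contradiction refl ¬p

  rotate-3 : rotate a b c c ≡ a
  rotate-3 with c ≟ a
  ... | yes p = contradiction (sym p) a≢c
  ... | no _ with c ≟ b
  ...   | yes p = contradiction (sym p) b≢c
  ...   | no _ with c ≟ c
  ...     | yes _ = refl
  ...     | no ¬p = contradiction refl ¬p

rotate-other : ∀ {n} {a b c z : Fin n} → z ≢ a → z ≢ b → z ≢ c → rotate a b c z ≡ z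
rotate-other {a = a} {b} {c} {z} z≢a z≢b z≢c with z ≟ a
... | yes p = contradiction p z≢a
... | no _ with z ≟ b
...   | yes p = contradiction p z≢b
...   | no _ with z ≟ c
...     | yes p = contradiction p z≢c
...     | no _ = refl

rotate-inverse : ∀ {n} {a b c : Fin n} → a ≢ b → a ≢ c → b ≢ c → ∀ z → rotate a c b (rotate a b c z) ≡ z
rotate-inverse {a = a} {b} {c} a≢b a≢c b≢c z with z ≟ a
... | yes refl = rotate-3 a≢c a≢b (≢-sym b≢c)
... | no z≢a with z ≟ b
...   | yes refl = rotate-2 a≢c a≢b (≢-sym b≢c)
...   | no z≢b with z ≟ c
...     | yes refl = rotate-1 a≢c a≢b (≢-sym b≢c)
...     | no z≢c = rotate-other z≢a z≢c z≢b

rotate-inj : ∀ {n} {a b c : Fin n} → a ≢ b → a ≢ c → b ≢ c → Inj (rotate a b c)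
rotate-inj {a = a} {b} {c} p q r eq =
  trans (sym (rotate-inverse p q r _)) (trans (cong (rotate a c b) eq) (rotate-inverse p q r _))

-- Uniqueness and existence of separations

same-pair : ∀ {A : Set} b₁ b₂ {x₁ y₁ x₂ y₂ : A} →
            (if b₁ then y₁ else x₁) ≡ (if b₂ then y₂ else x₂) →
            (if b₁ then x₁ else y₁) ≡ (if b₂ then x₂ else y₂) →
            (x₁ ≡ x₂ × y₁ ≡ y₂) ⊎ (x₁ ≡ y₂ × y₁ ≡ x₂)
same-pair true  true  e f = inj₁ (f , e)
same-pair true  false e f = inj₂ (f , e)
same-pair false true  e f = inj₂ (e , f)
same-pair false false e f = inj₁ (e , f)

module _ {k n : ℕ} where

  -- Equal results force equal unordered pairs in every row, by `same-pair`. So each `H` is closed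
  -- for the other array too, and minimality gives both inclusions. A row can be tested at its
  -- switched entry (`stable`) because closedness puts both of its entries in `H` or neither.
  Separation-unique :
    ∀ {v₁ w₁ v₂ w₂ : Fin k → Fin n} {inner p}
    (S₁ : Separation v₁ w₁ inner p) (S₂ : Separation v₂ w₂ inner p)
    (let H₁ = Separation.H S₁) (let H₂ = Separation.H S₂) →
    (∀ x → (if H₁ (v₁ x) then w₁ x else v₁ x) ≡ (if H₂ (v₂ x) then w₂ x else v₂ x)) →
    (∀ x → (if H₁ (v₁ x) then v₁ x else w₁ x) ≡ (if H₂ (v₂ x) then v₂ x else w₂ x)) →
    ∀ x → H₁ (v₁ x) ≡ H₂ (v₂ x)
  Separation-unique {v₁} {w₁} {v₂} {w₂} {inner} {p} S₁ S₂ v-eq w-eq x =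
    trans (sym (stable S₁ x)) (trans (ext _) (trans (cong M₂.H (v-eq x)) (stable S₂ x)))
    where
    module M₁ = Separation S₁
    module M₂ = Separation S₂
    stable : ∀ {v w inner p} (S : Separation v w inner p) (let open Separation S) →
             ∀ x → H (if H (v x) then w x else v x) ≡ H (v x)
    stable {v} S x with Separation.H S (v x) in eq
    ... | true  = trans (sym (Separation.closed S x)) eq
    ... | false = eq
    le : ∀ {v₁ w₁ v₂ w₂} (S₁ : Separation v₁ w₁ inner p) (S₂ : Separation v₂ w₂ inner p)
         (let H₁ = Separation.H S₁) (let H₂ = Separation.H S₂) →
         (∀ x → (if H₁ (v₁ x) then w₁ x else v₁ x) ≡ (if H₂ (v₂ x) then w₂ x else v₂ x)) →
         (∀ x → (if H₁ (v₁ x) then v₁ x else w₁ x) ≡ (if H₂ (v₂ x) then v₂ x else w₂ x)) →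
         ∀ z → Separation.H S₁ z ≡ true → Separation.H S₂ z ≡ true
    le {v₁} {w₁} {v₂} {w₂} S₁ S₂ v-eq w-eq = Separation.minimal S₁ N₂.H cl (proj₁ Hvw) (proj₂ Hvw)
      where
      module N₁ = Separation S₁
      module N₂ = Separation S₂
      cl : ∀ x → x ∉ inner → N₂.H (v₁ x) ≡ N₂.H (w₁ x)
      cl x _ with same-pair (N₁.H (v₁ x)) (N₂.H (v₂ x)) (v-eq x) (w-eq x)
      ... | inj₁ (e , f) = trans (cong N₂.H e) (trans (N₂.closed x) (cong N₂.H (sym f)))
      ... | inj₂ (e , f) = trans (cong N₂.H e) (trans (sym (N₂.closed x)) (cong N₂.H (sym f)))
      Hw₂ : N₂.H (w₂ p) ≡ true
      Hw₂ = trans (sym (N₂.closed p)) N₂.inside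
      Hvw : N₂.H (v₁ p) ≡ true × N₂.H (w₁ p) ≡ true
      Hvw with same-pair (N₁.H (v₁ p)) (N₂.H (v₂ p)) (v-eq p) (w-eq p)
      ... | inj₁ (e , f) = trans (cong N₂.H e) N₂.inside , trans (cong N₂.H f) Hw₂
      ... | inj₂ (e , f) = trans (cong N₂.H e) Hw₂ , trans (cong N₂.H f) N₂.inside
    ext : ∀ z → M₁.H z ≡ M₂.H z
    ext z with M₁.H z in e₁ | M₂.H z in e₂
    ... | true  | true  = refl
    ... | false | false = refl
    ... | true  | false = trans (sym (le S₁ S₂ v-eq w-eq z e₁)) e₂
    ... | false | true  = trans (sym e₁) (le S₂ S₁ (sym ∘ v-eq) (sym ∘ w-eq) z e₂)

  Permutes : (Fin k → Fin k) → List (Fin k) → Set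
  Permutes σ xs = (∀ {x} → x ∈ xs → σ x ∈ xs) × (∀ {x} → x ∉ xs → σ x ≡ x)

  module _ {v w : Fin k → Fin n} {inner : List (Fin k)} (ℓ : Labelling v w inner) where
    open Labelling ℓ

    Splits : (Fin k → Fin k) → Fin k → Set
    Splits σ p = ∀ q → q ∈ inner → q ≢ p → κ (v (σ q)) ≢ κ (w p) × κ (w q) ≢ κ (v (σ p))

    -- As `σ` moves only rows of `inner`, the labels made for `v` also serve `v*`. Of the four
    -- conditions of `separation`, the one between two sinks and the one between two sources are
    -- automatic; `Splits` keeps the two mixed ones.
    splits⇒separation : ∀ {v*} {σ : Fin k → Fin k} {p} → Inj σ → Permutes σ inner → p ∈ inner →
                        (∀ x → v* x ≡ v (σ x)) → Splits σ p → Separation v* w inner p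
    splits⇒separation {v*} {σ} {p} σ-inj (σ-in , σ-out) p∈ v*≡ splits = separation κ p∈
      (λ x x∉ → trans (cong κ (out x x∉)) (edge x x∉))
      (λ {H} cl → minimal {H} (λ x x∉ → trans (cong H (sym (out x x∉))) (cl x x∉)))
      (λ q q∈ q≢p → let a , b = splits q q∈ q≢p in
        ( (λ e → q≢p (σ-inj (sink (σ-in q∈) (σ-in p∈) (trans (sym (at q)) (trans e (at p))))))
        , (λ e → a (trans (sym (at q)) e)))
        , ((λ e → b (trans e (at p))) , (λ e → q≢p (source q∈ p∈ e))))
      where
      at : ∀ x → κ (v* x) ≡ κ (v (σ x))
      at x = cong κ (v*≡ x)
      out : ∀ x → x ∉ inner → v* x ≡ v x
      out x x∉ = trans (v*≡ x) (cong v (σ-out x∉))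

  -- If the given filling fails, a sink and a source belonging to different rows share a component.
  -- That component holds no other sink or source, which yields both conditions for the swapped
  -- filling.
  separation₂ : ∀ {v w : Fin k → Fin n} {p q} → Inj v → Inj w → p ≢ q →
                let inner = p ∷ q ∷ [] in
                Separation v w inner p
                ⊎ (∀ v* → (∀ x → v* x ≡ v (swap p q x)) → Separation v* w inner p)
  separation₂ {v} {w} {p} {q} v-inj w-inj p≢q = result
    where
    inner = p ∷ q ∷ []
    ℓ : Labelling v w inner
    ℓ = labelling v-inj w-inj inner
    open Labelling ℓ
    p∈ : p ∈ inner
    p∈ = here refl
    q∈ : q ∈ inner
    q∈ = there (here refl)
    swap-permutes : Permutes (swap p q) inner
    swap-permutes =
        (λ { (here refl) → subst (_∈ inner) (sym (swap-1 p q)) q∈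
           ; (there (here refl)) → subst (_∈ inner) (sym (swap-2 p q)) p∈ })
      , λ x∉ → swap-other (λ e → x∉ (here e)) (λ e → x∉ (there (here e)))
    splits : ∀ σ → κ (v (σ q)) ≢ κ (w p) → κ (w q) ≢ κ (v (σ p)) → Splits ℓ σ p
    splits σ a b _ (here refl)         q≢p = contradiction refl q≢p
    splits σ a b _ (there (here refl)) _   = a , b
    swapped : κ (v p) ≢ κ (w p) → κ (w q) ≢ κ (v q) →
              ∀ v* → (∀ x → v* x ≡ v (swap p q x)) → Separation v* w inner p
    swapped a b v* eq = splits⇒separation ℓ (swap-inj p q) swap-permutes p∈ eq
      (splits (swap p q) (λ e → a (trans (sym (cong (κ ∘ v) (swap-2 p q))) e)) (λ e → b (trans e (cong (κ ∘ v) (swap-1 p q)))))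
    result : _
    result with κ (v q) ≟ κ (w p) | κ (w q) ≟ κ (v p)
    ... | no a  | no b  = inj₁ (splits⇒separation ℓ (λ e → e) ((λ x → x) , λ _ → refl) p∈ (λ _ → refl) (splits (λ x → x) a b))
    ... | yes e | _     = inj₂ (swapped (λ f → p≢q (sink p∈ q∈ (trans f (sym e)))) (λ f → p≢q (source p∈ q∈ (trans (sym e) (sym f)))))
    ... | no _  | yes e = inj₂ (swapped (λ f → p≢q (source p∈ q∈ (trans (sym f) (sym e)))) (λ f → p≢q (sink p∈ q∈ (trans (sym e) f))))

  module _ {v w : Fin k → Fin n} {r₀ r₁ r₂ : Fin k} (r₀≢r₁ : r₀ ≢ r₁) (r₀≢r₂ : r₀ ≢ r₂) (r₁≢r₂ : r₁ ≢ r₂) where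

    private
      inner = r₀ ∷ r₁ ∷ r₂ ∷ []
      r₀∈ : r₀ ∈ inner
      r₀∈ = here refl
      r₁∈ : r₁ ∈ inner
      r₁∈ = there (here refl)
      r₂∈ : r₂ ∈ inner
      r₂∈ = there (there (here refl))

    -- A sink shares its component with at most one source; three distinct sinks
    -- leave one that shares it with neither r₁ nor r₂.
    separation₃ : Inj v → Inj w → ∃ λ (j : Fin 3) → ∀ v* → (∀ x → v* x ≡ v (rotate^ r₀ r₂ r₁ j x)) → Separation v* w inner r₀
    separation₃ v-inj w-inj = result
      where
      ℓ : Labelling v w inner
      ℓ = labelling v-inj w-inj inner
      open Labelling ℓ
      Free : Fin k → Set
      Free c = κ (w r₁) ≢ κ (v c) × κ (w r₂) ≢ κ (v c)
      Ok : Fin k → Fin k → Fin k → Set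
      Ok c d e = (κ (v d) ≢ κ (w r₀) × κ (v e) ≢ κ (w r₀)) × Free c
      splits : ∀ σ → Ok (σ r₀) (σ r₁) (σ r₂) → Splits ℓ σ r₀
      splits σ _ _ (here refl)                 q≢p = contradiction refl q≢p
      splits σ ((a , _) , (b , _)) _ (there (here refl))         _ = a , b
      splits σ ((_ , a) , (_ , b)) _ (there (there (here refl))) _ = a , b
      conclude : ∀ j {a b c} → let σ = rotate^ r₀ r₂ r₁ j in
                 Inj σ → Permutes σ inner → σ r₀ ≡ a → σ r₁ ≡ b → σ r₂ ≡ c → Ok a b c →
                 ∃ λ (j : Fin 3) → ∀ v* → (∀ x → v* x ≡ v (rotate^ r₀ r₂ r₁ j x)) → Separation v* w inner r₀
      conclude j inj perm refl refl refl ok = j , λ v* eq → splits⇒separation ℓ inj perm r₀∈ eq (splits _ ok)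
      p = r₀≢r₂
      q = r₀≢r₁
      r = ≢-sym r₁≢r₂
      ρ : Fin k → Fin k
      ρ = rotate r₀ r₂ r₁
      ρ-inj : Inj ρ
      ρ-inj = rotate-inj p q r
      ρ-in : ∀ {x} → x ∈ inner → ρ x ∈ inner
      ρ-in (here refl)                 = subst (_∈ inner) (sym (rotate-1 p q r)) r₂∈
      ρ-in (there (here refl))         = subst (_∈ inner) (sym (rotate-3 p q r)) r₀∈
      ρ-in (there (there (here refl))) = subst (_∈ inner) (sym (rotate-2 p q r)) r₁∈
      ρ-out : ∀ {x} → x ∉ inner → ρ x ≡ x
      ρ-out x∉ = rotate-other (λ { refl → x∉ r₀∈ }) (λ { refl → x∉ r₂∈ }) (λ { refl → x∉ r₁∈ })
      use₀ : Ok r₀ r₁ r₂ → _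
      use₀ = conclude zero (λ e → e) ((λ x → x) , λ _ → refl) refl refl refl
      use₁ : Ok r₂ r₀ r₁ → _
      use₁ = conclude (suc zero) ρ-inj (ρ-in , ρ-out) (rotate-1 p q r) (rotate-3 p q r) (rotate-2 p q r)
      use₂ : Ok r₁ r₂ r₀ → _
      use₂ = conclude (suc (suc zero)) (ρ-inj ∘ ρ-inj)
               (ρ-in ∘ ρ-in , λ x∉ → trans (cong ρ (ρ-out x∉)) (ρ-out x∉))
               (trans (cong ρ (rotate-1 p q r)) (rotate-2 p q r))
               (trans (cong ρ (rotate-3 p q r)) (rotate-1 p q r))
               (trans (cong ρ (rotate-2 p q r)) (rotate-3 p q r))
      hit : ∀ {c d e} → c ∈ inner → d ∈ inner → e ∈ inner → d ≢ c → e ≢ c → κ (v c) ≡ κ (w r₀) → Ok c d e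
      hit c∈ d∈ e∈ d≢c e≢c eq = ((λ f → d≢c (sink d∈ c∈ (trans f (sym eq)))) , (λ f → e≢c (sink e∈ c∈ (trans f (sym eq)))))
                              , ((λ f → r₀≢r₁ (source r₀∈ r₁∈ (trans (sym eq) (sym f)))) , (λ f → r₀≢r₂ (source r₀∈ r₂∈ (trans (sym eq) (sym f)))))
      free? : ∀ c → Free c ⊎ κ (w r₁) ≡ κ (v c) ⊎ κ (w r₂) ≡ κ (v c)
      free? c with κ (w r₁) ≟ κ (v c) | κ (w r₂) ≟ κ (v c)
      ... | yes e | _     = inj₂ (inj₁ e)
      ... | no _  | yes f = inj₂ (inj₂ f)
      ... | no a  | no b  = inj₁ (a , b)
      clash : ∀ {A : Set} {c d s} → c ∈ inner → d ∈ inner → c ≢ d → κ (w s) ≡ κ (v c) → κ (w s) ≡ κ (v d) → A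
      clash c∈ d∈ c≢d e f = contradiction (sink c∈ d∈ (trans (sym e) f)) c≢d
      free : Free r₀ ⊎ Free r₁ ⊎ Free r₂
      free with free? r₀ | free? r₁ | free? r₂
      ... | inj₁ f | _ | _ = inj₁ f
      ... | _ | inj₁ f | _ = inj₂ (inj₁ f)
      ... | _ | _ | inj₁ f = inj₂ (inj₂ f)
      ... | inj₂ (inj₁ a) | inj₂ (inj₁ b) | _ = clash r₀∈ r₁∈ r₀≢r₁ a b
      ... | inj₂ (inj₂ a) | inj₂ (inj₂ b) | _ = clash r₀∈ r₁∈ r₀≢r₁ a b
      ... | inj₂ (inj₁ a) | _ | inj₂ (inj₁ b) = clash r₀∈ r₂∈ r₀≢r₂ a b
      ... | inj₂ (inj₂ a) | _ | inj₂ (inj₂ b) = clash r₀∈ r₂∈ r₀≢r₂ a b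
      ... | _ | inj₂ (inj₁ a) | inj₂ (inj₁ b) = clash r₁∈ r₂∈ r₁≢r₂ a b
      ... | _ | inj₂ (inj₂ a) | inj₂ (inj₂ b) = clash r₁∈ r₂∈ r₁≢r₂ a b
      result : _
      -- A sink in the component of `w r₀` is given to `r₀`; as `w r₀` is the only source there,
      -- `r₁` and `r₂` stay away from it. If there is no such sink, any sink free of `r₁` and `r₂`
      -- will do.
      result with κ (v r₀) ≟ κ (w r₀) | κ (v r₁) ≟ κ (w r₀) | κ (v r₂) ≟ κ (w r₀)
      ... | yes e | _     | _     = use₀ (hit r₀∈ r₁∈ r₂∈ (≢-sym r₀≢r₁) (≢-sym r₀≢r₂) e)
      ... | no _  | yes e | _     = use₂ (hit r₁∈ r₂∈ r₀∈ (≢-sym r₁≢r₂) r₀≢r₁ e)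
      ... | no _  | no _  | yes e = use₁ (hit r₂∈ r₀∈ r₁∈ r₀≢r₂ r₁≢r₂ e)
      ... | no a  | no b  | no c with free
      ...   | inj₁ f        = use₀ ((b , c) , f)
      ...   | inj₂ (inj₁ f) = use₂ ((c , a) , f)
      ...   | inj₂ (inj₂ f) = use₁ ((a , b) , f)

-- Latin arrays and switches

Array : ℕ → ℕ → Set
Array k n = Fin k → Fin n → Fin n

Latin : ∀ {k n} → Array k n → Set
Latin f = (∀ i j j′ → f i j ≡ f i j′ → j ≡ j′) × (∀ j i i′ → f i j ≡ f i′ j → i ≡ i′)

matrix : ∀ {k n} → Array k n → Matrix k n
matrix f = tabulate λ i → tabulate (f i)

entry-matrix : ∀ {k n} (f : Array k n) i j → entry (matrix f) i j ≡ f i j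
entry-matrix f i j = trans (cong (λ r → lookup r j) (lookup∘tabulate _ i)) (lookup∘tabulate (f i) j)

lookup-ext : ∀ {A : Set} {n} (u v : Vec A n) → (∀ i → lookup u i ≡ lookup v i) → u ≡ v
lookup-ext u v eq = trans (sym (tabulate∘lookup u)) (trans (tabulate-cong eq) (tabulate∘lookup v))

entry-ext : ∀ {k n} (L M : Matrix k n) → (∀ i j → entry L i j ≡ entry M i j) → L ≡ M
entry-ext L M eq = lookup-ext L M λ i → lookup-ext (lookup L i) (lookup M i) (eq i)

latin-resp : ∀ {k n} {f g : Array k n} → (∀ i j → g i j ≡ f i j) → Latin f → Latin g
latin-resp eq (row , col) =
    (λ i j j′ e → row i j j′ (trans (sym (eq i j)) (trans e (eq i j′))))
  , (λ j i i′ e → col j i i′ (trans (sym (eq i j)) (trans e (eq i′ j))))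

latin-matrix : ∀ {k n} {f : Array k n} → Latin f → IsLatin (matrix f)
latin-matrix {f = f} = latin-resp (entry-matrix f)

permuted-latin : ∀ {k n} {f g : Array k n} (θ : Fin k → Fin n → Fin n) (φ : Fin n → Fin k → Fin k) →
                 (∀ x → Inj (θ x)) → (∀ z → Inj (φ z)) →
                 (∀ x z → g x z ≡ f x (θ x z)) → (∀ x z → g x z ≡ f (φ z x) z) →
                 Latin f → Latin g
permuted-latin θ φ θ-inj φ-inj gθ gφ (row , col) =
    (λ i j j′ e → θ-inj i (row i _ _ (trans (sym (gθ i j)) (trans e (gθ i j′)))))
  , (λ j i i′ e → φ-inj j (col j _ _ (trans (sym (gφ i j)) (trans e (gφ i′ j)))))

module ColumnSwitch {k n : ℕ} (c d : Fin n) where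

  switch : Array k n → (Fin n → Bool) → Array k n
  switch f H x z = if H (f x c) then f x (swap c d z) else f x z

  module _ (f : Array k n) (H : Fin n → Bool) where

    switch-c : ∀ x → switch f H x c ≡ (if H (f x c) then f x d else f x c)
    switch-c x rewrite swap-1 c d = refl

    switch-d : ∀ x → switch f H x d ≡ (if H (f x c) then f x c else f x d)
    switch-d x rewrite swap-2 c d = refl

    switch-other : ∀ x {z} → z ≢ c → z ≢ d → switch f H x z ≡ f x z
    switch-other x z≢c z≢d with H (f x c)
    ... | true  = cong (f x) (swap-other z≢c z≢d)
    ... | false = refl

    switch-out : ∀ x z → H (f x c) ≡ false → switch f H x z ≡ f x z
    switch-out x z e rewrite e = refl

    -- By closedness, in columns `c` and `d` the switched rows carry only symbols in `H` and the
    -- others only symbols outside, so the two kinds never collide. The other columns do not change.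
    switch-latin : Latin f → (∀ x → H (f x c) ≡ H (f x d)) → Latin (switch f H)
    switch-latin (row , col) closed = row′ , col′
      where
      row′ : ∀ i j j′ → switch f H i j ≡ switch f H i j′ → j ≡ j′
      row′ i j j′ e with H (f i c)
      ... | true  = swap-inj c d (row i _ _ e)
      ... | false = row i _ _ e
      clash : ∀ {x y z z′} {A : Set} → H (f x z) ≡ true → H (f y z′) ≡ false → f x z ≡ f y z′ → A
      clash ht hf e with () ← trans (sym ht) (trans (cong H e) hf)
      col′ : ∀ j i i′ → switch f H i j ≡ switch f H i′ j → i ≡ i′
      col′ j i i′ e with H (f i c) in p | H (f i′ c) in q
      ... | true  | true  = col _ _ _ e
      ... | false | false = col _ _ _ e
      ... | true  | false with j ≟ c
      ...   | yes refl = clash (trans (sym (closed i)) p) q e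
      ...   | no _ with j ≟ d
      ...     | yes refl = clash p (trans (sym (closed i′)) q) e
      ...     | no _ = col _ _ _ e
      col′ j i i′ e | false | true with j ≟ c
      ...   | yes refl = clash (trans (sym (closed i′)) q) p (sym e)
      ...   | no _ with j ≟ d
      ...     | yes refl = clash q (trans (sym (closed i)) p) (sym e)
      ...     | no _ = col _ _ _ e

  -- Once `Separation-unique` has told which rows were switched, the switch is undone by repeating
  -- it.
  switch-injective : ∀ {f g : Array k n} {inner p}
    (S : Separation (λ x → f x c) (λ x → f x d) inner p) (T : Separation (λ x → g x c) (λ x → g x d) inner p) →
    (∀ x z → switch f (Separation.H S) x z ≡ switch g (Separation.H T) x z) → ∀ x z → f x z ≡ g x z
  switch-injective {f} {g} S T eq x z = undo (same x) (eq x)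
    where
    H₁ = Separation.H S
    H₂ = Separation.H T
    same : ∀ x → H₁ (f x c) ≡ H₂ (g x c)
    same = Separation-unique S T
      (λ x → trans (sym (switch-c f H₁ x)) (trans (eq x c) (switch-c g H₂ x)))
      (λ x → trans (sym (switch-d f H₁ x)) (trans (eq x d) (switch-d g H₂ x)))
    undo : H₁ (f x c) ≡ H₂ (g x c) → (∀ z → switch f H₁ x z ≡ switch g H₂ x z) → f x z ≡ g x z
    undo e eq with H₁ (f x c) | H₂ (g x c) | e
    ... | true  | _ | refl = trans (cong (f x) (sym (swap-involutive c d z))) (trans (eq (swap c d z)) (cong (g x) (swap-involutive c d z)))
    ... | false | _ | refl = eq z

injective⇒surjective : ∀ {n} {f : Fin n → Fin n} → Inj f → ∀ a → ∃ λ j → f j ≡ a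
injective⇒surjective {n} {f} inj a with any? (λ j → f j ≟ a)
... | yes p = p
... | no ¬p with pigeonhole (ℕ.n<1+n n) (λ { zero → a ; (suc j) → f j })
...   | zero  , suc j , _   , e = contradiction (j , sym e) ¬p
...   | suc i , suc j , i<j , e = contradiction (cong Fin.toℕ (inj e)) (ℕ.<⇒≢ (ℕ.≤-pred i<j))

module SymbolSwitch {k n : ℕ} (a u : Fin n) where

  module _ (f : Array k n) (lat : Latin f) where

    -- A row has as many cells as there are symbols, so each symbol occurs in it. This is the
    -- conjugate array, with the roles of columns and symbols exchanged.
    locate : Fin n → Fin k → Fin n
    locate s x = proj₁ (injective⇒surjective (proj₁ lat x _ _) s)

    at-locate : ∀ s x → f x (locate s x) ≡ s
    at-locate s x = proj₂ (injective⇒surjective (proj₁ lat x _ _) s)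

    locate-unique : ∀ {s x z} → f x z ≡ s → z ≡ locate s x
    locate-unique {s} {x} e = proj₁ lat x _ _ (trans e (sym (at-locate s x)))

    locate-inj : ∀ s → Inj (locate s)
    locate-inj s {x} {y} e = proj₂ lat (locate s x) _ _
      (trans (at-locate s x) (trans (sym (at-locate s y)) (cong (f y) (sym e))))

    switch : (Fin n → Bool) → Array k n
    switch H x z = if H (locate a x) then swap a u (f x z) else f x z

    module _ (H : Fin n → Bool) where

      -- Seen through `locate`, a symbol switch exchanges two columns of the conjugate array, which
      -- is the form that `Separation-unique` expects.
      switch-a : ∀ x → switch H x (if H (locate a x) then locate u x else locate a x) ≡ a
      switch-a x with H (locate a x)
      ... | true  = trans (cong (swap a u) (at-locate u x)) (swap-2 a u)
      ... | false = at-locate a x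

      switch-u : ∀ x → switch H x (if H (locate a x) then locate a x else locate u x) ≡ u
      switch-u x with H (locate a x)
      ... | true  = trans (cong (swap a u) (at-locate a x)) (swap-1 a u)
      ... | false = at-locate u x

      switch-other : ∀ x {z} → f x z ≢ a → f x z ≢ u → switch H x z ≡ f x z
      switch-other x ≢a ≢u with H (locate a x)
      ... | true  = swap-other ≢a ≢u
      ... | false = refl

      switch-out : ∀ x z → H (locate a x) ≡ false → switch H x z ≡ f x z
      switch-out x z e rewrite e = refl

      switch-latin : (∀ x → H (locate a x) ≡ H (locate u x)) → Latin (switch H)
      switch-latin closed = row′ , col′
        where
        row′ : ∀ i j j′ → switch H i j ≡ switch H i j′ → j ≡ j′
        row′ i j j′ e with H (locate a i)
        ... | true  = proj₁ lat i _ _ (swap-inj a u e)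
        ... | false = proj₁ lat i _ _ e
        clash : ∀ {y z z′} {A : Set} → H y ≡ true → H z′ ≡ false → z ≡ y → z ≡ z′ → A
        clash ht hf refl refl with () ← trans (sym ht) hf
        mixed : ∀ j i i′ → H (locate a i) ≡ true → H (locate a i′) ≡ false →
                swap a u (f i j) ≡ f i′ j → i ≡ i′
        mixed j i i′ p q e with f i j ≟ a
        ... | yes ea = clash p (trans (sym (closed i′)) q) (locate-unique ea)
                         (locate-unique (sym e))
        ... | no _ with f i j ≟ u
        ...   | yes eu = clash (trans (sym (closed i)) p) q (locate-unique eu)
                         (locate-unique (sym e))
        ...   | no _ = proj₂ lat j _ _ e
        col′ : ∀ j i i′ → switch H i j ≡ switch H i′ j → i ≡ i′
        col′ j i i′ e with H (locate a i) in p | H (locate a i′) in q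
        ... | true  | true  = proj₂ lat j _ _ (swap-inj a u e)
        ... | false | false = proj₂ lat j _ _ e
        ... | true  | false = mixed j i i′ p q e
        ... | false | true  = sym (mixed j i′ i q p (sym e))

  switch-injective : ∀ {f g : Array k n} (lf : Latin f) (lg : Latin g) {inner p}
    (S : Separation (locate f lf a) (locate f lf u) inner p) (T : Separation (locate g lg a) (locate g lg u) inner p) →
    (∀ x z → switch f lf (Separation.H S) x z ≡ switch g lg (Separation.H T) x z) → ∀ x z → f x z ≡ g x z
  switch-injective {f} {g} lf lg S T eq x z = undo (same x) (eq x z)
    where
    H₁ = Separation.H S
    H₂ = Separation.H T
    row : ∀ x {y z} → switch f lf H₁ x y ≡ switch f lf H₁ x z → y ≡ z
    row x = proj₁ (switch-latin f lf H₁ (Separation.closed S)) x _ _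
    same : ∀ x → H₁ (locate f lf a x) ≡ H₂ (locate g lg a x)
    same = Separation-unique S T
      (λ x → row x (trans (switch-a f lf H₁ x) (sym (trans (eq x _) (switch-a g lg H₂ x)))))
      (λ x → row x (trans (switch-u f lf H₁ x) (sym (trans (eq x _) (switch-u g lg H₂ x)))))
    undo : H₁ (locate f lf a x) ≡ H₂ (locate g lg a x) → switch f lf H₁ x z ≡ switch g lg H₂ x z → f x z ≡ g x z
    undo e eq with H₁ (locate f lf a x) | H₂ (locate g lg a x) | e
    ... | true  | _ | refl = swap-inj a u eq
    ... | false | _ | refl = eq

-- Injections between predicates

-- A relation in place of a function: the image involves choices, and only its existence and the
-- recovery of the preimage count. Keeping `P` and `Q` apart from the data makes `injective` an
-- equality of bare data, free of proofs.
record _↪_ {A B : Set} (P : A → Set) (Q : B → Set) : Set₁ where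
  field
    _↦_       : A → B → Set
    total     : ∀ a → P a → ∃ λ b → Q b × a ↦ b
    injective : ∀ {a a′ b} → P a → P a′ → Q b → a ↦ b → a′ ↦ b → a ≡ a′

infixr 2 _⟫_
_⟫_ : ∀ {A B C : Set} {P : A → Set} {Q : B → Set} {R : C → Set} → P ↪ Q → Q ↪ R → P ↪ R
_⟫_ {Q = Q} F G = record
  { _↦_ = λ a c → ∃ λ b → Q b × F._↦_ a b × G._↦_ b c
  ; total = λ a p → let b , q , f = F.total a p ; c , r , g = G.total b q in c , r , (b , q , f , g)
  ; injective = λ { p p′ r (b , q , f , g) (b′ , q′ , f′ , g′) →
      let e = G.injective q q′ r g g′ in F.injective p p′ q f (subst (F._↦_ _) (sym e) f′) } }
  where
  module F = _↪_ F
  module G = _↪_ G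

_⊗ʳ_ : ∀ {A B : Set} {P : A → Set} {Q : B → Set} → P ↪ Q → (C : Set) →
       (λ (x : A × C) → P (proj₁ x)) ↪ (λ (y : B × C) → Q (proj₁ y))
F ⊗ʳ C = record
  { _↦_ = λ (a , c) (b , d) → F._↦_ a b × c ≡ d
  ; total = λ (a , c) p → let b , q , f = F.total a p in (b , c) , q , f , refl
  ; injective = λ { p p′ q (f , refl) (f′ , refl) → cong (_, _) (F.injective p p′ q f f′) } }
  where module F = _↪_ F

unique-⊆⇒length-≤ : ∀ {A : Set} {xs ys : List A} → Unique xs → (∀ {x} → x ∈ xs → x ∈ ys) → length xs ℕ.≤ length ys
unique-⊆⇒length-≤ {xs = []} _ _ = z≤n
unique-⊆⇒length-≤ {xs = x ∷ xs} (x∉ AllPairs.∷ uniq) sub with as , bs , refl ← ∈-∃++ (sub (here refl)) =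
  subst (suc (length xs) ℕ.≤_) (sym len) (s≤s (unique-⊆⇒length-≤ uniq sub′))
  where
  len : length (as ++ x ∷ bs) ≡ suc (length (as ++ bs))
  len = trans (length-++ as) (trans (ℕ.+-suc (length as) (length bs)) (cong suc (sym (length-++ as))))
  sub′ : ∀ {y} → y ∈ xs → y ∈ as ++ bs
  sub′ y∈ with ∈-++⁻ as (sub (there y∈))
  ... | inj₁ p             = ∈-++⁺ˡ p
  ... | inj₂ (here refl)   = contradiction refl (All.lookup x∉ y∈)
  ... | inj₂ (there p)     = ∈-++⁺ʳ as p

lookup-injective : ∀ {A : Set} {xs : List A} → Unique xs → ∀ {i j} → List.lookup xs i ≡ List.lookup xs j → i ≡ j
lookup-injective (_ AllPairs.∷ _) {zero}  {zero}  _ = refl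
lookup-injective {xs = _ ∷ xs} (x∉ AllPairs.∷ _) {zero}  {suc j} e = contradiction e (All.lookup x∉ (∈-lookup {xs = xs} j))
lookup-injective {xs = _ ∷ xs} (x∉ AllPairs.∷ _) {suc i} {zero}  e = contradiction (sym e) (All.lookup x∉ (∈-lookup {xs = xs} i))
lookup-injective (_ AllPairs.∷ u) {suc i} {suc j} e = cong suc (lookup-injective u e)

module _ {n : ℕ} (cs : List (Fin n)) where
  private
    out? = λ x → ¬? (x ∈? cs)
    rest = filter out? (allFin n)
    enough : n ∸ length cs ℕ.≤ length rest
    enough = ℕ.m≤n+o⇒m∸n≤o n (length cs) (subst (n ℕ.≤_) (length-++ cs)
      (subst (ℕ._≤ length (cs ++ rest)) (length-tabulate (λ x → x)) (unique-⊆⇒length-≤ (allFin⁺ n) cover)))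
      where
      cover : ∀ {x} → x ∈ allFin n → x ∈ cs ++ rest
      cover {x} x∈ with x ∈? cs
      ... | yes p = ∈-++⁺ˡ p
      ... | no ¬p = ∈-++⁺ʳ cs (∈-filter⁺ out? x∈ ¬p)

  -- A list with repetitions leaves more than `n ∸ length cs` elements; `inject≤` restricts to the
  -- guaranteed number, so that the number of choices is uniform.
  avoid : Fin (n ∸ length cs) → Fin n
  avoid i = List.lookup rest (inject≤ i enough)

  avoid-∉ : ∀ i → avoid i ∉ cs
  avoid-∉ i = proj₂ (∈-filter⁻ out? {xs = allFin n} (∈-lookup (inject≤ i enough)))

  avoid-injective : ∀ {i j} → avoid i ≡ avoid j → i ≡ j
  avoid-injective e = Fin.inject≤-injective enough enough _ _ (lookup-injective (filter⁺ out? (allFin⁺ n)) e)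

-- Refilling a block

Separation-resp : ∀ {k n} {v w v′ w′ : Fin k → Fin n} {inner p} → (∀ x → v x ≡ v′ x) → (∀ x → w x ≡ w′ x) →
                  Separation v w inner p → Separation v′ w′ inner p
Separation-resp {p = p} v≡ w≡ S = record
  { H = H
  ; closed = λ x → trans (cong H (sym (v≡ x))) (trans (closed x) (cong H (w≡ x)))
  ; inside = trans (cong H (sym (v≡ p))) inside
  ; outside = λ q q∈ q≢ → trans (cong H (sym (v≡ q))) (outside q q∈ q≢)
  ; minimal = λ H′ cl Hv Hw → minimal H′
      (λ x x∉ → trans (cong H′ (v≡ x)) (trans (cl x x∉) (cong H′ (sym (w≡ x)))))
      (trans (cong H′ (v≡ p)) Hv) (trans (cong H′ (w≡ p)) Hw) }
  where open Separation S

-- Rewrites a block so that each of its rows is permuted by σ and, equivalently, each of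
-- its columns by τ; the two descriptions give the two halves of the Latin property.
module Refill {k n : ℕ} (rows : List (Fin k)) (columns : List (Fin n))
              {σ : Fin k → Fin n → Fin n} {τ : Fin n → Fin k → Fin k}
              (σ-inj : ∀ x → Inj (σ x)) (τ-inj : ∀ z → Inj (τ z))
              (σ-off : ∀ x {z} → z ∉ columns → σ x z ≡ z) (τ-off : ∀ z {x} → x ∉ rows → τ z x ≡ x) where

  private
    θ : Fin k → Fin n → Fin n
    θ x z = if does (x ∈? rows) then σ x z else z

    φ : Fin n → Fin k → Fin k
    φ z x = if does (z ∈? columns) then τ z x else x

    θ-inj : ∀ x → Inj (θ x)
    θ-inj x with does (x ∈? rows)
    ... | true  = σ-inj x
    ... | false = λ e → e

    φ-inj : ∀ z → Inj (φ z)
    φ-inj z with does (z ∈? columns)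
    ... | true  = τ-inj z
    ... | false = λ e → e

  refill : Matrix k n → Matrix k n
  refill L = matrix λ x z → entry L x (θ x z)

  refill-in : ∀ L {x z z′} → x ∈ rows → σ x z ≡ z′ → entry (refill L) x z ≡ entry L x z′
  refill-in L {x} {z} x∈ refl = trans (entry-matrix _ x z)
    (cong (λ b → entry L x (if b then σ x z else z)) (dec-true (x ∈? rows) x∈))

  refill-row : ∀ L {x z} → x ∉ rows → entry (refill L) x z ≡ entry L x z
  refill-row L {x} {z} x∉ = trans (entry-matrix _ x z)
    (cong (λ b → entry L x (if b then σ x z else z)) (dec-false (x ∈? rows) x∉))

  refill-column : ∀ L {x z} → z ∉ columns → entry (refill L) x z ≡ entry L x z
  refill-column L {x} z∉ with x ∈? rows
  ... | yes x∈ = refill-in L x∈ (σ-off x z∉)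
  ... | no  x∉ = refill-row L x∉

  -- The cells are moved by `θ`, which depends on the block and not on the rectangle.
  refill-injective : ∀ L M → refill L ≡ refill M → L ≡ M
  refill-injective L M e = entry-ext L M λ x z → let y , θy = injective⇒surjective (θ-inj x) z in
    subst (λ z → entry L x z ≡ entry M x z) θy
      (trans (sym (entry-matrix _ x y)) (trans (cong (λ N → entry N x y) e) (entry-matrix _ x y)))

  module _ (L : Matrix k n)
           (exchange : ∀ {x z} → x ∈ rows → z ∈ columns → entry L x (σ x z) ≡ entry L (τ z x) z) where

    refill-τ : ∀ x {z} → z ∈ columns → entry (refill L) x z ≡ entry L (τ z x) z
    refill-τ x {z} z∈ with x ∈? rows
    ... | yes x∈ = trans (refill-in L x∈ refl) (exchange x∈ z∈)
    ... | no  x∉ = trans (refill-row L x∉) (cong (λ y → entry L y z) (sym (τ-off z x∉)))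

    refill-latin : IsLatin L → IsLatin (refill L)
    refill-latin = permuted-latin θ φ θ-inj φ-inj (entry-matrix _) via-φ
      where
      via-φ : ∀ x z → entry (refill L) x z ≡ entry L (φ z x) z
      via-φ x z with z ∈? columns
      ... | yes z∈ = refill-τ x z∈
      ... | no  z∉ = refill-column L z∉

-- The patterns and the three switches

record Frame (k n : ℕ) : Set where
  constructor frame
  field
    r₀ r₁ r₂ : Fin k
    c₀ c₁ c₂ : Fin n

  rows : List (Fin k)
  rows = r₀ ∷ r₁ ∷ r₂ ∷ []

  columns : List (Fin n)
  columns = c₀ ∷ c₁ ∷ c₂ ∷ []

  r₀∈ : r₀ ∈ rows
  r₀∈ = here refl
  r₁∈ : r₁ ∈ rows
  r₁∈ = there (here refl)
  r₂∈ : r₂ ∈ rows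
  r₂∈ = there (there (here refl))

  record Distinct : Set where
    field
      r₀≢r₁ : r₀ ≢ r₁
      r₀≢r₂ : r₀ ≢ r₂
      r₁≢r₂ : r₁ ≢ r₂
      c₀≢c₁ : c₀ ≢ c₁
      c₀≢c₂ : c₀ ≢ c₂
      c₁≢c₂ : c₁ ≢ c₂

  -- Up to its symbols s₀, s₁, s₂, the array reads
  --   s₀ s₁ s₂
  --   s₂ s₀ s₁
  --   s₁ s₂ s₀
  -- on the rows r₀, r₁, r₂ and the columns c₀, c₁, c₂.
  record Square (f : Array k n) : Set where
    field
      distinct : Distinct
      s₀₁ : f r₀ c₀ ≡ f r₁ c₁
      s₀₂ : f r₁ c₁ ≡ f r₂ c₂
      s₁₁ : f r₀ c₁ ≡ f r₁ c₂
      s₁₂ : f r₁ c₂ ≡ f r₂ c₀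
      s₂₁ : f r₀ c₂ ≡ f r₁ c₀
      s₂₂ : f r₁ c₀ ≡ f r₂ c₁
    open Distinct distinct public

  -- The same pattern, except that row r₀ has s₂ in column d instead of c₂.
  record Holed (f : Array k n) (d : Fin n) : Set where
    field
      distinct : Distinct
      d∉  : d ∉ columns
      s₀₁ : f r₀ c₀ ≡ f r₁ c₁
      s₀₂ : f r₁ c₁ ≡ f r₂ c₂
      s₁₁ : f r₀ c₁ ≡ f r₁ c₂
      s₁₂ : f r₁ c₂ ≡ f r₂ c₀
      s₂₁ : f r₀ d  ≡ f r₁ c₀
      s₂₂ : f r₁ c₀ ≡ f r₂ c₁
    open Distinct distinct public

IsSquare : ∀ {k n} → Matrix k n × Frame k n → Set
IsSquare (L , F) = IsLatin L × Frame.Square F (entry L)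

IsHoled : ∀ {k n} → Matrix k n × Frame k n × Fin n → Set
IsHoled (L , F , d) = IsLatin L × Frame.Holed F (entry L) d

-- Shifts each row of the square cyclically. Since the pattern is itself cyclic, each of its columns
-- undergoes the cyclic shift of rows that `separation₃` asks for, and the pattern persists with its
-- symbols renamed.
module Turn {k n : ℕ} (F : Frame k n) (D : Frame.Distinct F) where
  open Frame F
  open Distinct D

  private
    c₀↦ = rotate-1 c₀≢c₁ c₀≢c₂ c₁≢c₂
    c₁↦ = rotate-2 c₀≢c₁ c₀≢c₂ c₁≢c₂
    c₂↦ = rotate-3 c₀≢c₁ c₀≢c₂ c₁≢c₂
    r₀↦ = rotate-1 r₀≢r₂ r₀≢r₁ (≢-sym r₁≢r₂)
    r₂↦ = rotate-2 r₀≢r₂ r₀≢r₁ (≢-sym r₁≢r₂)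
    r₁↦ = rotate-3 r₀≢r₂ r₀≢r₁ (≢-sym r₁≢r₂)

  module R = Refill rows columns
    {λ _ → rotate c₀ c₁ c₂} {λ _ → rotate r₀ r₂ r₁}
    (λ _ → rotate-inj c₀≢c₁ c₀≢c₂ c₁≢c₂) (λ _ → rotate-inj r₀≢r₂ r₀≢r₁ (≢-sym r₁≢r₂))
    (λ _ z∉ → rotate-other (z∉ ∘ here) (z∉ ∘ there ∘ here) (z∉ ∘ there ∘ there ∘ here))
    (λ _ x∉ → rotate-other (x∉ ∘ here) (x∉ ∘ there ∘ there ∘ here) (x∉ ∘ there ∘ here))
  open R using (refill-in; refill-τ; refill-latin)
  open R public using () renaming (refill to turn; refill-injective to turn-injective; refill-column to turn-column)

  module _ (L : Matrix k n) (S : Square (entry L)) where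
    open Square S
    private
      cell : ∀ {x z z′ y} → rotate c₀ c₁ c₂ z ≡ z′ → rotate r₀ r₂ r₁ x ≡ y → entry L x z′ ≡ entry L y z →
             entry L x (rotate c₀ c₁ c₂ z) ≡ entry L (rotate r₀ r₂ r₁ x) z
      cell refl refl e = e
      exchange : ∀ {x z} → x ∈ rows → z ∈ columns → entry L x (rotate c₀ c₁ c₂ z) ≡ entry L (rotate r₀ r₂ r₁ x) z
      exchange (here refl) (here refl)                                 = cell c₀↦ r₀↦ (trans s₁₁ s₁₂)
      exchange (here refl) (there (here refl))                         = cell c₁↦ r₀↦ (trans s₂₁ s₂₂)
      exchange (here refl) (there (there (here refl)))                 = cell c₂↦ r₀↦ (trans s₀₁ s₀₂)
      exchange (there (here refl)) (here refl)                         = cell c₀↦ r₁↦ (sym s₀₁)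
      exchange (there (here refl)) (there (here refl))                 = cell c₁↦ r₁↦ (sym s₁₁)
      exchange (there (here refl)) (there (there (here refl)))         = cell c₂↦ r₁↦ (sym s₂₁)
      exchange (there (there (here refl))) (here refl)                 = cell c₀↦ r₂↦ (sym s₂₂)
      exchange (there (there (here refl))) (there (here refl))         = cell c₁↦ r₂↦ (sym s₀₂)
      exchange (there (there (here refl))) (there (there (here refl))) = cell c₂↦ r₂↦ (sym s₁₂)
      link : ∀ {x x′ y y′ z z′} → x ∈ rows → x′ ∈ rows → rotate c₀ c₁ c₂ y ≡ z → rotate c₀ c₁ c₂ y′ ≡ z′ →
             entry L x z ≡ entry L x′ z′ → entry (turn L) x y ≡ entry (turn L) x′ y′
      link x∈ x′∈ ρ ρ′ e = trans (refill-in L x∈ ρ) (trans e (sym (refill-in L x′∈ ρ′)))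

    turn-τ : ∀ x {z} → z ∈ columns → entry (turn L) x z ≡ entry L (rotate r₀ r₂ r₁ x) z
    turn-τ = refill-τ L exchange

    turn-latin : IsLatin L → IsLatin (turn L)
    turn-latin = refill-latin L exchange

    turn-square : Square (entry (turn L))
    turn-square = record
      { distinct = distinct
      ; s₀₁ = link r₀∈ r₁∈ c₀↦ c₁↦ s₁₁ ; s₀₂ = link r₁∈ r₂∈ c₁↦ c₂↦ s₁₂
      ; s₁₁ = link r₀∈ r₁∈ c₁↦ c₂↦ s₂₁ ; s₁₂ = link r₁∈ r₂∈ c₂↦ c₀↦ s₂₂
      ; s₂₁ = link r₀∈ r₁∈ c₂↦ c₀↦ s₀₁ ; s₂₂ = link r₁∈ r₂∈ c₀↦ c₁↦ s₀₂ }

  turn^ : Fin 3 → Matrix k n → Matrix k n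
  turn^ zero             L = L
  turn^ (suc zero)       L = turn L
  turn^ (suc (suc zero)) L = turn (turn L)

  turn^-square : ∀ j L → IsSquare (L , F) → IsSquare (turn^ j L , F)
  turn^-square zero             L p       = p
  turn^-square (suc zero)       L (l , s) = turn-latin L s l , turn-square L s
  turn^-square (suc (suc zero)) L (l , s) =
    turn-latin (turn L) (turn-square L s) (turn-latin L s l) , turn-square (turn L) (turn-square L s)

  turn^-injective : ∀ j L M → turn^ j L ≡ turn^ j M → L ≡ M
  turn^-injective zero             L M e = e
  turn^-injective (suc zero)       L M e = turn-injective L M e
  turn^-injective (suc (suc zero)) L M e = turn-injective L M (turn-injective _ _ e)

  turn^-column : ∀ j L {x z} → z ∉ columns → entry (turn^ j L) x z ≡ entry L x z
  turn^-column zero             L z∉ = refl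
  turn^-column (suc zero)       L z∉ = turn-column L z∉
  turn^-column (suc (suc zero)) L z∉ = trans (turn-column (turn L) z∉) (turn-column L z∉)

  turn^-τ : ∀ j L → Square (entry L) → ∀ x {z} → z ∈ columns →
            entry (turn^ j L) x z ≡ entry L (rotate^ r₀ r₂ r₁ j x) z
  turn^-τ zero             L S x z∈ = refl
  turn^-τ (suc zero)       L S x z∈ = turn-τ L S x z∈
  turn^-τ (suc (suc zero)) L S x z∈ = trans (turn-τ (turn L) (turn-square L S) x z∈) (turn-τ L S _ z∈)

record ColumnSwitched {k n} (c d : Fin n) (inner : List (Fin k)) (p : Fin k) (L M : Matrix k n) : Set where
  field
    separated : Separation (λ x → entry L x c) (λ x → entry L x d) inner p
  open Separation separated using (H; inside; outside) public
  field
    switched : ∀ x z → entry M x z ≡ ColumnSwitch.switch c d (entry L) H x z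

  switched-p : entry M p d ≡ entry L p c
  switched-p rewrite switched p d | inside | swap-2 c d = refl

  unswitched-row : ∀ {q z} → q ∈ inner → q ≢ p → entry M q z ≡ entry L q z
  unswitched-row {q} {z} q∈ q≢p = trans (switched q z) (ColumnSwitch.switch-out c d (entry L) H q z (outside q q∈ q≢p))

  unswitched-column : ∀ {x z} → z ≢ c → z ≢ d → entry M x z ≡ entry L x z
  unswitched-column {x} z≢c z≢d = trans (switched x _) (ColumnSwitch.switch-other c d (entry L) H x z≢c z≢d)

columnSwitch : ∀ {k n} {c d : Fin n} {inner : List (Fin k)} {p} (L : Matrix k n) → IsLatin L →
               Separation (λ x → entry L x c) (λ x → entry L x d) inner p →
               ∃ λ M → IsLatin M × ColumnSwitched c d inner p L M
columnSwitch {c = c} {d} L lat S =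
  matrix f , latin-matrix (switch-latin (entry L) H lat closed) , record { separated = S ; switched = entry-matrix f }
  where
  open Separation S
  open ColumnSwitch c d
  f = switch (entry L) H

columnSwitched-injective : ∀ {k n} {c d : Fin n} {inner : List (Fin k)} {p} {L L′ M : Matrix k n} →
                           ColumnSwitched c d inner p L M → ColumnSwitched c d inner p L′ M → L ≡ L′
columnSwitched-injective {c = c} {d} {L = L} {L′} S T = entry-ext L L′
  (ColumnSwitch.switch-injective c d S.separated T.separated λ x z → trans (sym (S.switched x z)) (T.switched x z))
  where
  module S = ColumnSwitched S
  module T = ColumnSwitched T

-- The first switch: squares to holed squares

module _ {k n : ℕ} where

  data Scatter₁ : (Matrix k n × Frame k n) × Fin (n ∸ 3) → Fin 3 × (Matrix k n × Frame k n × Fin n) → Set where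
    scatter₁ : ∀ {L F i M d} j (let open Frame F) → d ≡ avoid columns i →
               (D : Distinct) → ColumnSwitched c₂ d rows r₀ (Turn.turn^ F D j L) M → Scatter₁ ((L , F) , i) (j , M , F , d)

  -- The image keeps the frame, the new column `d` and the number `j` of turns. Hence `i` can be
  -- read off from `d`, and undoing the switch and then the turns restores the rectangle.
  square↪holed : (λ (x : (Matrix k n × Frame k n) × Fin (n ∸ 3)) → IsSquare (proj₁ x)) ↪
                 (λ (y : Fin 3 × (Matrix k n × Frame k n × Fin n)) → IsHoled (proj₂ y))
  square↪holed = record { _↦_ = Scatter₁ ; total = total ; injective = injective }
    where
    -- The turned rectangle depends on the frame only; `D` enters the proofs about it.
    same : ∀ F (D D′ : Frame.Distinct F) j L → Turn.turn^ F D j L ≡ Turn.turn^ F D′ j L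
    same F D D′ zero             L = refl
    same F D D′ (suc zero)       L = refl
    same F D D′ (suc (suc zero)) L = refl
    injective : ∀ {a a′ b} → IsSquare (proj₁ a) → IsSquare (proj₁ a′) → IsHoled (proj₂ b) → Scatter₁ a b → Scatter₁ a′ b → a ≡ a′
    injective {(L , F) , i} {(L′ , _) , i′} _ _ _ (scatter₁ j e D S) (scatter₁ .j e′ D′ S′)
      with refl ← avoid-injective (Frame.columns F) {i} {i′} (trans (sym e) e′)
         | refl ← Turn.turn^-injective F D j L L′ (trans (columnSwitched-injective S S′) (same F D′ D j L′)) = refl
    total : ∀ a → IsSquare (proj₁ a) → ∃ λ b → IsHoled (proj₂ b) × Scatter₁ a b
    total ((L , F) , i) (lat , s) =
      let j , sep = separation₃ s.r₀≢r₁ s.r₀≢r₂ s.r₁≢r₂ (proj₂ lat c₂ _ _) (proj₂ lat d _ _)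
          L* = turn^ j L
          lat* , s* = turn^-square j L (lat , s)
          -- Column `d` lies outside the block, so turning permutes the sinks in `c₂` while the
          -- sources in `d` stay put.
          S = Separation-resp (λ _ → refl) (λ x → sym (turn^-column j L d∉))
                (sep (λ x → entry L* x c₂) λ x → turn^-τ j L s x (there (there (here refl))))
          M , latM , sw = columnSwitch L* lat* S
      in (j , M , F , d) , (latM , holed s* sw) , scatter₁ j refl s.distinct sw
      where
      open Frame F
      module s = Square s
      open Turn F s.distinct
      d : Fin n
      d = avoid columns i
      d∉ : d ∉ columns
      d∉ = avoid-∉ columns i
      holed : ∀ {L M} → Square (entry L) → ColumnSwitched c₂ d rows r₀ L M → Holed (entry M) d
      holed {L} {M} s sw = record
        { distinct = distinct ; d∉ = d∉
        ; s₀₁ = keep r₀c₀ r₁z s₀₁ ; s₀₂ = keep r₁z r₂z s₀₂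
        ; s₁₁ = keep r₀c₁ r₁z s₁₁ ; s₁₂ = keep r₁z r₂z s₁₂
        ; s₂₁ = keep switched-p r₁z s₂₁ ; s₂₂ = keep r₁z r₂z s₂₂ }
        where
        open Square s
        open ColumnSwitched sw
        keep : ∀ {x x′ z z′ y y′} → entry M x z ≡ y → entry M x′ z′ ≡ y′ → y ≡ y′ → entry M x z ≡ entry M x′ z′
        keep a b e = trans a (trans e (sym b))
        r₀c₀ = unswitched-column {r₀} c₀≢c₂ (λ e → d∉ (here (sym e)))
        r₀c₁ = unswitched-column {r₀} c₁≢c₂ (λ e → d∉ (there (here (sym e))))
        r₁z = λ {z} → unswitched-row {r₁} {z} r₁∈ (≢-sym r₀≢r₁)
        r₂z = λ {z} → unswitched-row {r₂} {z} r₂∈ (≢-sym r₀≢r₂)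

-- The second switch: holed squares to 3-cycles

record Strip (k n : ℕ) : Set where
  constructor strip
  field
    r₀ r₁ r₂ : Fin k
    c₀ c₁    : Fin n

  -- The first two columns of a Square:
  --   s₀ s₁
  --   s₂ s₀
  --   s₁ s₂
  record Cycle (f : Array k n) : Set where
    field
      r₀≢r₁ : r₀ ≢ r₁
      r₀≢r₂ : r₀ ≢ r₂
      r₁≢r₂ : r₁ ≢ r₂
      c₀≢c₁ : c₀ ≢ c₁
      s₀ : f r₀ c₀ ≡ f r₁ c₁
      s₁ : f r₀ c₁ ≡ f r₂ c₀
      s₂ : f r₁ c₀ ≡ f r₂ c₁

IsCycle : ∀ {k n} → Matrix k n × Strip k n → Set
IsCycle (L , T) = IsLatin L × Strip.Cycle T (entry L)

-- Exchanges the rows r₁ and r₂ on the columns of the frame; exchanging the labels of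
-- c₀ and c₁ restores the pattern.
module Reflect {k n : ℕ} (F : Frame k n) (D : Frame.Distinct F) where
  open Frame F
  open Distinct D

  private
    pair : List (Fin k)
    pair = r₁ ∷ r₂ ∷ []

    -- Rows `r₁` and `r₂` carry the same symbols on these columns, displaced by one place;
    -- exchanging them therefore rotates one row forwards and the other backwards.
    σ : Fin k → Fin n → Fin n
    σ x with x ≟ r₁
    ... | yes _ = rotate c₀ c₂ c₁
    ... | no  _ = rotate c₀ c₁ c₂

    σ-inj : ∀ x → Inj (σ x)
    σ-inj x with x ≟ r₁
    ... | yes _ = rotate-inj c₀≢c₂ c₀≢c₁ (≢-sym c₁≢c₂)
    ... | no  _ = rotate-inj c₀≢c₁ c₀≢c₂ c₁≢c₂

    σ-off : ∀ x {z} → z ∉ columns → σ x z ≡ z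
    σ-off x z∉ with x ≟ r₁
    ... | yes _ = rotate-other (z∉ ∘ here) (z∉ ∘ there ∘ there ∘ here) (z∉ ∘ there ∘ here)
    ... | no  _ = rotate-other (z∉ ∘ here) (z∉ ∘ there ∘ here) (z∉ ∘ there ∘ there ∘ here)

    σ-r₁ : ∀ z → σ r₁ z ≡ rotate c₀ c₂ c₁ z
    σ-r₁ z with r₁ ≟ r₁
    ... | yes _ = refl
    ... | no ¬p = contradiction refl ¬p

    σ-r₂ : ∀ z → σ r₂ z ≡ rotate c₀ c₁ c₂ z
    σ-r₂ z with r₂ ≟ r₁
    ... | yes e = contradiction (sym e) r₁≢r₂
    ... | no _  = refl

    r₁c₀ : σ r₁ c₀ ≡ c₂
    r₁c₀ = trans (σ-r₁ c₀) (rotate-1 c₀≢c₂ c₀≢c₁ (≢-sym c₁≢c₂))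
    r₁c₁ : σ r₁ c₁ ≡ c₀
    r₁c₁ = trans (σ-r₁ c₁) (rotate-3 c₀≢c₂ c₀≢c₁ (≢-sym c₁≢c₂))
    r₁c₂ : σ r₁ c₂ ≡ c₁
    r₁c₂ = trans (σ-r₁ c₂) (rotate-2 c₀≢c₂ c₀≢c₁ (≢-sym c₁≢c₂))
    r₂c₀ : σ r₂ c₀ ≡ c₁
    r₂c₀ = trans (σ-r₂ c₀) (rotate-1 c₀≢c₁ c₀≢c₂ c₁≢c₂)
    r₂c₁ : σ r₂ c₁ ≡ c₂
    r₂c₁ = trans (σ-r₂ c₁) (rotate-2 c₀≢c₁ c₀≢c₂ c₁≢c₂)
    r₂c₂ : σ r₂ c₂ ≡ c₀
    r₂c₂ = trans (σ-r₂ c₂) (rotate-3 c₀≢c₁ c₀≢c₂ c₁≢c₂)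

    r₀∉ : r₀ ∉ pair
    r₀∉ (here e)         = r₀≢r₁ e
    r₀∉ (there (here e)) = r₀≢r₂ e

    module R = Refill pair columns {σ} {λ _ → swap r₁ r₂} σ-inj (λ _ → swap-inj r₁ r₂) σ-off
      (λ _ x∉ → swap-other (x∉ ∘ here) (x∉ ∘ there ∘ here))
  open R using (refill-in; refill-row; refill-τ; refill-latin)
  open R public using () renaming (refill to reflect; refill-injective to reflect-injective; refill-column to reflect-column)

  mirrored : Frame k n
  mirrored = frame r₀ r₁ r₂ c₁ c₀ c₂

  module _ (L : Matrix k n) {d : Fin n} (S : Holed (entry L) d) where
    open Holed S using (d∉; s₀₁; s₀₂; s₁₁; s₁₂; s₂₁; s₂₂)
    private
      cell : ∀ {x z z′ y} → σ x z ≡ z′ → swap r₁ r₂ x ≡ y → entry L x z′ ≡ entry L y z →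
             entry L x (σ x z) ≡ entry L (swap r₁ r₂ x) z
      cell refl refl e = e
      exchange : ∀ {x z} → x ∈ pair → z ∈ columns → entry L x (σ x z) ≡ entry L (swap r₁ r₂ x) z
      exchange (here refl) (here refl)                         = cell r₁c₀ (swap-1 r₁ r₂) s₁₂
      exchange (here refl) (there (here refl))                 = cell r₁c₁ (swap-1 r₁ r₂) s₂₂
      exchange (here refl) (there (there (here refl)))         = cell r₁c₂ (swap-1 r₁ r₂) s₀₂
      exchange (there (here refl)) (here refl)                 = cell r₂c₀ (swap-2 r₁ r₂) (sym s₂₂)
      exchange (there (here refl)) (there (here refl))         = cell r₂c₁ (swap-2 r₁ r₂) (sym s₀₂)
      exchange (there (here refl)) (there (there (here refl))) = cell r₂c₂ (swap-2 r₁ r₂) (sym s₁₂)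
      link : ∀ {x x′ z z′ y y′} → entry (reflect L) x z ≡ y → entry (reflect L) x′ z′ ≡ y′ → y ≡ y′ →
             entry (reflect L) x z ≡ entry (reflect L) x′ z′
      link a b e = trans a (trans e (sym b))
      r₀* : ∀ {z} → entry (reflect L) r₀ z ≡ entry L r₀ z
      r₀* = refill-row L r₀∉
      r₁* : ∀ {z z′} → σ r₁ z ≡ z′ → entry (reflect L) r₁ z ≡ entry L r₁ z′
      r₁* = refill-in L (here refl)
      r₂* : ∀ {z z′} → σ r₂ z ≡ z′ → entry (reflect L) r₂ z ≡ entry L r₂ z′
      r₂* = refill-in L (there (here refl))

    reflect-swap : ∀ x {z} → z ∈ columns → entry (reflect L) x z ≡ entry L (swap r₁ r₂ x) z
    reflect-swap = refill-τ L exchange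

    reflect-latin : IsLatin L → IsLatin (reflect L)
    reflect-latin = refill-latin L exchange

    reflect-holed : Frame.Holed mirrored (entry (reflect L)) d
    reflect-holed = record
      { distinct = record
          { r₀≢r₁ = r₀≢r₁ ; r₀≢r₂ = r₀≢r₂ ; r₁≢r₂ = r₁≢r₂
          ; c₀≢c₁ = ≢-sym c₀≢c₁ ; c₀≢c₂ = c₁≢c₂ ; c₁≢c₂ = c₀≢c₂ }
      ; d∉ = λ { (here e) → d∉ (there (here e)) ; (there (here e)) → d∉ (here e) ; (there (there e)) → d∉ (there (there e)) }
      ; s₀₁ = link r₀* (r₁* r₁c₀) s₁₁ ; s₀₂ = link (r₁* r₁c₀) (r₂* r₂c₂) s₁₂
      ; s₁₁ = link r₀* (r₁* r₁c₂) s₀₁ ; s₁₂ = link (r₁* r₁c₂) (r₂* r₂c₁) s₀₂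
      ; s₂₁ = link r₀* (r₁* r₁c₁) s₂₁ ; s₂₂ = link (r₁* r₁c₁) (r₂* r₂c₀) s₂₂ }

module _ {k n : ℕ} where

  record Opened (L : Matrix k n) (F : Frame k n) (d₁ d₂ : Fin n) (M : Matrix k n) (T : Strip k n) : Set where
    open Frame F
    field
      -- Avoiding `d₁` too keeps the second switch from moving the symbol that the first one put
      -- there, so that `d₁` can still be found afterwards. This is the origin of `n ∸ 4`.
      d₂∉      : d₂ ∉ c₀ ∷ c₁ ∷ c₂ ∷ d₁ ∷ []
      switched : ColumnSwitched c₂ d₂ (r₁ ∷ r₂ ∷ []) r₁ L M
      label    : T ≡ strip r₀ r₁ r₂ c₀ c₁

  -- The three scattered symbols of the lost column are read off the two remaining columns.
  opened-injective : ∀ {L F d₁ d₂ L′ F′ d₁′ d₂′ M T} → IsHoled (L , F , d₁) → IsHoled (L′ , F′ , d₁′) → IsLatin M →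
                     Opened L F d₁ d₂ M T → Opened L′ F′ d₁′ d₂′ M T →
                     (L ≡ L′ × F ≡ F′) × (d₁ ≡ d₁′ × d₂ ≡ d₂′)
  opened-injective {L} {F@(frame r₀ r₁ r₂ c₀ c₁ c₂)} {d₁} {d₂} {L′} {F′} {d₁′} {d₂′} {M} (_ , h) (_ , h′) (row , _)
    o@record { label = refl } o′@record { label = refl } = conclude
      (row r₀ _ _ (trans (at-d₁ h o) (sym (at-d₁ h′ o′))))
      (row r₁ _ _ (trans (at-d₂ h o) (sym (at-d₂ h′ o′))))
      (row r₂ _ _ (trans (at-c₂ h o) (sym (at-c₂ h′ o′))))
      (Opened.switched o) (Opened.switched o′)
    where
    module _ {L : Matrix k n} {c₂ d₁ d₂} (h : Frame.Holed (frame r₀ r₁ r₂ c₀ c₁ c₂) (entry L) d₁)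
             (o : Opened L (frame r₀ r₁ r₂ c₀ c₁ c₂) d₁ d₂ M (strip r₀ r₁ r₂ c₀ c₁)) where
      open Frame.Holed h
      open Opened o
      open ColumnSwitched switched
      z₀ : ∀ {x} → entry M x c₀ ≡ entry L x c₀
      z₀ = unswitched-column c₀≢c₂ (λ e → d₂∉ (here (sym e)))
      z₁ : ∀ {x} → entry M x c₁ ≡ entry L x c₁
      z₁ = unswitched-column c₁≢c₂ (λ e → d₂∉ (there (here (sym e))))
      at-d₁ : entry M r₀ d₁ ≡ entry M r₁ c₀
      at-d₁ = trans (unswitched-column (λ e → d∉ (there (there (here e)))) (λ e → d₂∉ (there (there (there (here (sym e)))))))
                (trans s₂₁ (sym z₀))
      at-d₂ : entry M r₁ d₂ ≡ entry M r₀ c₁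
      at-d₂ = trans switched-p (trans (sym s₁₁) (sym z₁))
      at-c₂ : entry M r₂ c₂ ≡ entry M r₀ c₀
      at-c₂ = trans (unswitched-row (there (here refl)) (≢-sym r₁≢r₂)) (trans (sym (trans s₀₁ s₀₂)) (sym z₀))
    conclude : ∀ {L′ c₂′ d₁′ d₂′} → d₁ ≡ d₁′ → d₂ ≡ d₂′ → c₂ ≡ c₂′ →
               ColumnSwitched c₂ d₂ (r₁ ∷ r₂ ∷ []) r₁ L M → ColumnSwitched c₂′ d₂′ (r₁ ∷ r₂ ∷ []) r₁ L′ M →
               (L ≡ L′ × F ≡ frame r₀ r₁ r₂ c₀ c₁ c₂′) × (d₁ ≡ d₁′ × d₂ ≡ d₂′)
    conclude refl refl refl S S′ = (columnSwitched-injective S S′ , refl) , (refl , refl)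

  opened : ∀ {L F d₁ d₂} (let open Frame F) → IsHoled (L , F , d₁) → d₂ ∉ c₀ ∷ c₁ ∷ c₂ ∷ d₁ ∷ [] →
           Separation (λ x → entry L x c₂) (λ x → entry L x d₂) (r₁ ∷ r₂ ∷ []) r₁ →
           ∃ λ y → IsCycle y × Opened L F d₁ d₂ (proj₁ y) (proj₂ y)
  opened {L} {F} {d₁} {d₂} (lat , h) d₂∉ S =
    let M , latM , sw = columnSwitch L lat S
    in (M , strip r₀ r₁ r₂ c₀ c₁) , (latM , cycle sw) , record { d₂∉ = d₂∉ ; switched = sw ; label = refl }
    where
    open Frame F
    open Holed h
    cycle : ∀ {M} → ColumnSwitched c₂ d₂ (r₁ ∷ r₂ ∷ []) r₁ L M → Strip.Cycle (strip r₀ r₁ r₂ c₀ c₁) (entry M)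
    cycle {M} sw = record
      { r₀≢r₁ = r₀≢r₁ ; r₀≢r₂ = r₀≢r₂ ; r₁≢r₂ = r₁≢r₂ ; c₀≢c₁ = c₀≢c₁
      ; s₀ = keep z₀ z₁ s₀₁ ; s₁ = keep z₁ z₀ (trans s₁₁ s₁₂) ; s₂ = keep z₀ z₁ s₂₂ }
      where
      open ColumnSwitched sw
      keep : ∀ {x x′ z z′ y y′} → entry M x z ≡ y → entry M x′ z′ ≡ y′ → y ≡ y′ → entry M x z ≡ entry M x′ z′
      keep a b e = trans a (trans e (sym b))
      z₀ : ∀ {x} → entry M x c₀ ≡ entry L x c₀
      z₀ = unswitched-column c₀≢c₂ (λ e → d₂∉ (here (sym e)))
      z₁ : ∀ {x} → entry M x c₁ ≡ entry L x c₁
      z₁ = unswitched-column c₁≢c₂ (λ e → d₂∉ (there (here (sym e))))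

  data Scatter₂ : (Matrix k n × Frame k n × Fin n) × Fin (n ∸ 4) → Bool × (Matrix k n × Strip k n) → Set where
    direct    : ∀ {L F d₁ i d₂ M T} (let open Frame F) → d₂ ≡ avoid (c₀ ∷ c₁ ∷ c₂ ∷ d₁ ∷ []) i →
                Opened L F d₁ d₂ M T → Scatter₂ ((L , F , d₁) , i) (false , M , T)
    reflected : ∀ {L F d₁ i d₂ M T} (let open Frame F) (D : Distinct) → d₂ ≡ avoid (c₀ ∷ c₁ ∷ c₂ ∷ d₁ ∷ []) i →
                Opened (Reflect.reflect F D L) (Reflect.mirrored F D) d₁ d₂ M T → Scatter₂ ((L , F , d₁) , i) (true , M , T)

  -- The `Bool` is the code of the filling. The image forgets `c₂`, `d₁` and `d₂`;
  -- `opened-injective` restores them.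
  holed↪cycle : (λ (x : (Matrix k n × Frame k n × Fin n) × Fin (n ∸ 4)) → IsHoled (proj₁ x)) ↪
                (λ (y : Bool × (Matrix k n × Strip k n)) → IsCycle (proj₂ y))
  holed↪cycle = record { _↦_ = Scatter₂ ; total = total ; injective = injective }
    where
    mirror : ∀ {L F d} (D : Frame.Distinct F) → IsHoled (L , F , d) → IsHoled (Reflect.reflect F D L , Reflect.mirrored F D , d)
    mirror {L} {F} D (lat , h) = Reflect.reflect-latin F D L h lat , Reflect.reflect-holed F D L h
    unmirror : ∀ {F F′} (D : Frame.Distinct F) (D′ : Frame.Distinct F′) → Reflect.mirrored F D ≡ Reflect.mirrored F′ D′ → F ≡ F′
    unmirror _ _ refl = refl
    injective : ∀ {a a′ b} → IsHoled (proj₁ a) → IsHoled (proj₁ a′) → IsCycle (proj₂ b) → Scatter₂ a b → Scatter₂ a′ b → a ≡ a′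
    injective p p′ (latM , _) (direct {F = F} {i = i} e o) (direct {i = i′} e′ o′)
      with opened-injective p p′ latM o o′
    ... | (refl , refl) , (refl , refl) with refl ← avoid-injective _ {i} {i′} (trans (sym e) e′) = refl
    injective p p′ (latM , _) (reflected {L} {F} {i = i} D e o) (reflected {L′} {F′} {i = i′} D′ e′ o′)
      with opened-injective (mirror {L} {F} D p) (mirror {L′} {F′} D′ p′) latM o o′
    ... | (eL , eF) , (refl , refl) with refl ← unmirror {F} {F′} D D′ eF
                                    with refl ← avoid-injective _ {i} {i′} (trans (sym e) e′)
                                       | refl ← Reflect.reflect-injective F D L L′ eL = refl
    total : ∀ a → IsHoled (proj₁ a) → ∃ λ b → IsCycle (proj₂ b) × Scatter₂ a b
    total ((L , F , d₁) , i) (lat , h) with separation₂ (proj₂ lat c₂ _ _) (proj₂ lat (avoid (c₀ ∷ c₁ ∷ c₂ ∷ d₁ ∷ []) i) _ _) r₁≢r₂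
      where
      open Frame F
      open Holed h
    ... | inj₁ S = let y , q , o = opened (lat , h) (avoid-∉ _ i) S in (false , y) , q , direct refl o
    ... | inj₂ S =
      let y , q , o = opened (mirror {L} {F} distinct (lat , h)) d₂∉′ S* in (true , y) , q , reflected distinct refl o
      where
      open Frame F
      open Holed h
      d₂ : Fin n
      d₂ = avoid (c₀ ∷ c₁ ∷ c₂ ∷ d₁ ∷ []) i
      d₂∉ : d₂ ∉ c₀ ∷ c₁ ∷ c₂ ∷ d₁ ∷ []
      d₂∉ = avoid-∉ _ i
      d₂∉′ : d₂ ∉ c₁ ∷ c₀ ∷ c₂ ∷ d₁ ∷ []
      d₂∉′ (here e)         = d₂∉ (there (here e))
      d₂∉′ (there (here e)) = d₂∉ (here e)
      d₂∉′ (there (there e)) = d₂∉ (there (there e))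
      d₂∉columns : d₂ ∉ columns
      d₂∉columns (here e)                 = d₂∉ (here e)
      d₂∉columns (there (here e))         = d₂∉ (there (here e))
      d₂∉columns (there (there (here e))) = d₂∉ (there (there (here e)))
      open Reflect F distinct
      S* : Separation (λ x → entry (reflect L) x c₂) (λ x → entry (reflect L) x d₂) (r₁ ∷ r₂ ∷ []) r₁
      S* = Separation-resp (λ _ → refl) (λ x → sym (reflect-column L d₂∉columns))
             (S (λ x → entry (reflect L) x c₂) λ x → reflect-swap L h x (there (there (here refl))))

-- The third switch: 3-cycles to seeds

-- Exchanges the two columns on the three rows. The symbol of `(r₀ , c₀)` also lies at `(r₁ , c₁)`,
-- so its positions in `r₀` and `r₁` are interchanged: this is the swap of sinks offered by
-- `separation₂`. Exchanging the labels `c₀` and `c₁` restores the pattern.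
module Flip {k n : ℕ} (T : Strip k n) {f : Array k n} (C : Strip.Cycle T f) where
  open Strip T
  open Cycle C using (r₀≢r₁; r₀≢r₂; r₁≢r₂; c₀≢c₁)

  rows : List (Fin k)
  rows = r₀ ∷ r₁ ∷ r₂ ∷ []

  columns : List (Fin n)
  columns = c₀ ∷ c₁ ∷ []

  flipped : Strip k n
  flipped = strip r₀ r₁ r₂ c₁ c₀

  private
    τ : Fin n → Fin k → Fin k
    τ z with z ≟ c₀
    ... | yes _ = rotate r₀ r₂ r₁
    ... | no  _ = rotate r₀ r₁ r₂

    τ-inj : ∀ z → Inj (τ z)
    τ-inj z with z ≟ c₀
    ... | yes _ = rotate-inj r₀≢r₂ r₀≢r₁ (≢-sym r₁≢r₂)
    ... | no  _ = rotate-inj r₀≢r₁ r₀≢r₂ r₁≢r₂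

    τ-off : ∀ z {x} → x ∉ rows → τ z x ≡ x
    τ-off z x∉ with z ≟ c₀
    ... | yes _ = rotate-other (x∉ ∘ here) (x∉ ∘ there ∘ there ∘ here) (x∉ ∘ there ∘ here)
    ... | no  _ = rotate-other (x∉ ∘ here) (x∉ ∘ there ∘ here) (x∉ ∘ there ∘ there ∘ here)

    τ-c₀ : ∀ x → τ c₀ x ≡ rotate r₀ r₂ r₁ x
    τ-c₀ x with c₀ ≟ c₀
    ... | yes _ = refl
    ... | no ¬p = contradiction refl ¬p

    τ-c₁ : ∀ x → τ c₁ x ≡ rotate r₀ r₁ r₂ x
    τ-c₁ x with c₁ ≟ c₀
    ... | yes e = contradiction (sym e) c₀≢c₁
    ... | no _  = refl

    module R = Refill rows columns {λ _ → swap c₀ c₁} {τ} (λ _ → swap-inj c₀ c₁) τ-inj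
      (λ _ z∉ → swap-other (z∉ ∘ here) (z∉ ∘ there ∘ here)) τ-off
  open R using (refill-in; refill-latin)
  open R public using () renaming (refill to flip; refill-injective to flip-injective; refill-row to flip-row; refill-column to flip-column)

  flip-c₀ : ∀ L {x} → x ∈ rows → entry (flip L) x c₀ ≡ entry L x c₁
  flip-c₀ L x∈ = refill-in L x∈ (swap-1 c₀ c₁)

  flip-c₁ : ∀ L {x} → x ∈ rows → entry (flip L) x c₁ ≡ entry L x c₀
  flip-c₁ L x∈ = refill-in L x∈ (swap-2 c₀ c₁)

  module _ (L : Matrix k n) (C : Cycle (entry L)) where
    open Cycle C using (s₀; s₁; s₂)
    private
      cell : ∀ {x z z′ y} → swap c₀ c₁ z ≡ z′ → τ z x ≡ y → entry L x z′ ≡ entry L y z →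
             entry L x (swap c₀ c₁ z) ≡ entry L (τ z x) z
      cell refl refl e = e
      in₀ = swap-1 c₀ c₁
      in₁ = swap-2 c₀ c₁
      exchange : ∀ {x z} → x ∈ rows → z ∈ columns → entry L x (swap c₀ c₁ z) ≡ entry L (τ z x) z
      exchange (here refl) (here refl)                         = cell in₀ (trans (τ-c₀ _) (rotate-1 r₀≢r₂ r₀≢r₁ (≢-sym r₁≢r₂))) s₁
      exchange (there (here refl)) (here refl)                 = cell in₀ (trans (τ-c₀ _) (rotate-3 r₀≢r₂ r₀≢r₁ (≢-sym r₁≢r₂))) (sym s₀)
      exchange (there (there (here refl))) (here refl)         = cell in₀ (trans (τ-c₀ _) (rotate-2 r₀≢r₂ r₀≢r₁ (≢-sym r₁≢r₂))) (sym s₂)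
      exchange (here refl) (there (here refl))                 = cell in₁ (trans (τ-c₁ _) (rotate-1 r₀≢r₁ r₀≢r₂ r₁≢r₂)) s₀
      exchange (there (here refl)) (there (here refl))         = cell in₁ (trans (τ-c₁ _) (rotate-2 r₀≢r₁ r₀≢r₂ r₁≢r₂)) s₂
      exchange (there (there (here refl))) (there (here refl)) = cell in₁ (trans (τ-c₁ _) (rotate-3 r₀≢r₁ r₀≢r₂ r₁≢r₂)) (sym s₁)

    flip-latin : IsLatin L → IsLatin (flip L)
    flip-latin = refill-latin L exchange

    flip-cycle : Strip.Cycle flipped (entry (flip L))
    flip-cycle = record
      { r₀≢r₁ = r₀≢r₁ ; r₀≢r₂ = r₀≢r₂ ; r₁≢r₂ = r₁≢r₂ ; c₀≢c₁ = ≢-sym c₀≢c₁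
      ; s₀ = trans (flip-c₁ L (here refl)) (trans s₀ (sym (flip-c₀ L (there (here refl)))))
      ; s₁ = trans (flip-c₀ L (here refl)) (trans s₁ (sym (flip-c₁ L (there (there (here refl))))))
      ; s₂ = trans (flip-c₁ L (there (here refl))) (trans s₂ (sym (flip-c₀ L (there (there (here refl)))))) }

module _ {k n : ℕ} where

  cycleSymbols : Matrix k n → Strip k n → List (Fin n)
  cycleSymbols L (strip r₀ r₁ r₂ c₀ c₁) = entry L r₀ c₀ ∷ entry L r₀ c₁ ∷ entry L r₁ c₀ ∷ []

  record Broken (L : Matrix k n) (T : Strip k n) (u : Fin n) (M : Matrix k n) (seed : Fin k × Fin n × Fin n) : Set where
    open Strip T
    field
      -- A field of its own, tied to the entry by `a≡`, so that the symbols of two preimages can be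
      -- identified before their rectangles are known to agree.
      {a}       : Fin n
      a≡        : entry L r₀ c₀ ≡ a
      u∉        : u ∉ cycleSymbols L T
      latin     : IsLatin L
    open SymbolSwitch {k} a u
    field
      separated : Separation (locate (entry L) latin a) (locate (entry L) latin u) (r₀ ∷ r₁ ∷ []) r₀
    open Separation separated using (H; inside; outside) public
    field
      switched  : ∀ x z → entry M x z ≡ switch (entry L) latin H x z
      label     : seed ≡ (r₁ , c₀ , c₁)

  -- The hole is left at (r₀ , c₀); the other five cells are read off from r₁, c₀ and c₁.
  module _ {L : Matrix k n} {T u M seed} (C : Strip.Cycle T (entry L)) (B : Broken L T u M seed) where
    open Strip T
    open Cycle C
    open Broken B
    open SymbolSwitch {k} a u

    private
      row₁ : ∀ {z} → entry M r₁ z ≡ entry L r₁ z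
      row₁ {z} = trans (switched r₁ z) (switch-out (entry L) latin H r₁ z (outside r₁ (there (here refl)) (≢-sym r₀≢r₁)))
      keep : ∀ {x z} → entry L x z ≢ a → entry L x z ≢ u → entry M x z ≡ entry L x z
      keep {x} {z} ≢a ≢u = trans (switched x z) (switch-other (entry L) latin H x {z} ≢a ≢u)
      s₁≢a : entry L r₀ c₁ ≢ a
      s₁≢a e = c₀≢c₁ (sym (proj₁ latin _ _ _ (trans e (sym a≡))))
      s₁≢u : entry L r₀ c₁ ≢ u
      s₁≢u e = u∉ (there (here (sym e)))
      s₂≢a : entry L r₁ c₀ ≢ a
      s₂≢a e = c₀≢c₁ (proj₁ latin _ _ _ (trans e (trans (sym a≡) s₀)))
      s₂≢u : entry L r₁ c₀ ≢ u
      s₂≢u e = u∉ (there (there (here (sym e))))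

    broken-r₂ : entry M r₂ c₁ ≡ entry M r₁ c₀
    broken-r₂ = trans (keep (s₂≢a ∘ trans s₂) (s₂≢u ∘ trans s₂)) (trans (sym s₂) (sym row₁))

    broken-r₀ : entry M r₀ c₁ ≡ entry M r₂ c₀
    broken-r₀ = trans (keep s₁≢a s₁≢u) (trans s₁ (sym (keep (s₁≢a ∘ trans s₁) (s₁≢u ∘ trans s₁))))

    broken-a : a ≡ entry M r₁ c₁
    broken-a = trans (sym a≡) (trans s₀ (sym row₁))

    broken-u : u ≡ entry M r₀ c₀
    broken-u = sym (trans (switched r₀ c₀) (trans
      (cong (λ b → if b then swap a u (entry L r₀ c₀) else entry L r₀ c₀) inside)
      (trans (cong (swap a u) a≡) (swap-1 a u))))

  broken-injective : ∀ {L T u L′ T′ u′ M seed} → Strip.Cycle T (entry L) → Strip.Cycle T′ (entry L′) → IsLatin M →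
                     Broken L T u M seed → Broken L′ T′ u′ M seed → (L ≡ L′ × T ≡ T′) × u ≡ u′
  broken-injective {L} {strip r₀ r₁ r₂ c₀ c₁} {u} {L′} {strip r₀′ .r₁ r₂′ .c₀ .c₁} {u′} {M} C C′ (_ , col)
    B@record { label = refl } B′@record { label = refl }
    -- The symbol of `(r₁ , c₀)` marks `r₂` in column `c₁`; then the symbol of `(r₂ , c₀)` marks
    -- `r₀` in the same column.
    with refl ← col c₁ _ _ (trans (broken-r₂ C B) (sym (broken-r₂ C′ B′)))
    with refl ← col c₁ _ _ (trans (broken-r₀ C B) (sym (broken-r₀ C′ B′))) =
    conclude B B′ (trans (broken-u C B) (sym (broken-u C′ B′))) (trans (broken-a C B) (sym (broken-a C′ B′)))
    where
    T : Strip k n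
    T = strip r₀ r₁ r₂ c₀ c₁
    conclude : ∀ {u′} (B : Broken L T u M (r₁ , c₀ , c₁)) (B′ : Broken L′ T u′ M (r₁ , c₀ , c₁)) → u ≡ u′ →
               Broken.a B ≡ Broken.a B′ → (L ≡ L′ × T ≡ T) × u ≡ u′
    conclude record { a = a ; latin = l ; separated = S ; switched = sw } record { latin = l′ ; separated = S′ ; switched = sw′ } refl refl =
      (entry-ext L L′ (SymbolSwitch.switch-injective a u l l′ S S′ λ x z → trans (sym (sw x z)) (sw′ x z)) , refl) , refl

  broken : ∀ {L T a u} (let open Strip T) (lat : IsLatin L) → entry L r₀ c₀ ≡ a → u ∉ cycleSymbols L T →
           (let open SymbolSwitch {k} a u) →
           Separation (locate (entry L) lat a) (locate (entry L) lat u) (r₀ ∷ r₁ ∷ []) r₀ →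
           ∃ λ M → IsLatin M × Broken L T u M (r₁ , c₀ , c₁)
  broken {L} {T} {a} {u} lat a≡ u∉ S =
      matrix f , latin-matrix (switch-latin (entry L) lat H closed)
    , record { a≡ = a≡ ; u∉ = u∉ ; latin = lat ; separated = S ; switched = entry-matrix f ; label = refl }
    where
    open Separation S
    open SymbolSwitch {k} a u
    f = switch (entry L) lat H

  data Break : (Matrix k n × Strip k n) × Fin (n ∸ 3) → Bool × (Matrix k n × (Fin k × Fin n × Fin n)) → Set where
    direct  : ∀ {L T i u M seed} → u ≡ avoid (cycleSymbols L T) i → Broken L T u M seed →
              Break ((L , T) , i) (false , M , seed)
    flipped : ∀ {L T i u M seed f} (C : Strip.Cycle T f) → u ≡ avoid (cycleSymbols L T) i →
              Broken (Flip.flip T C L) (Flip.flipped T C) u M seed → Break ((L , T) , i) (true , M , seed)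

  cycle↪seed : (λ (x : (Matrix k n × Strip k n) × Fin (n ∸ 3)) → IsCycle (proj₁ x)) ↪
               (λ (y : Bool × (Matrix k n × (Fin k × Fin n × Fin n))) → IsLatin (proj₁ (proj₂ y)))
  cycle↪seed = record { _↦_ = Break ; total = total ; injective = injective }
    where
    unflip : ∀ {T T′ f g} (C : Strip.Cycle T f) (C′ : Strip.Cycle T′ g) → Flip.flipped T C ≡ Flip.flipped T′ C′ → T ≡ T′
    unflip _ _ refl = refl
    injective : ∀ {a a′ b} → IsCycle (proj₁ a) → IsCycle (proj₁ a′) → IsLatin (proj₁ (proj₂ b)) → Break a b → Break a′ b → a ≡ a′
    injective (_ , c) (_ , c′) latM (direct {i = i} e B) (direct {i = i′} e′ B′)
      with (refl , refl) , refl ← broken-injective c c′ latM B B′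
      with refl ← avoid-injective _ {i} {i′} (trans (sym e) e′) = refl
    injective {(L , T) , i} {(L′ , T′) , i′} (_ , c) (_ , c′) latM (flipped C e B) (flipped C′ e′ B′)
      with broken-injective (Flip.flip-cycle T C L c) (Flip.flip-cycle T′ C′ L′ c′) latM B B′
    ... | (eL , eT) , refl with refl ← unflip C C′ eT
                           with refl ← Flip.flip-injective T C L L′ eL
                           with refl ← avoid-injective _ {i} {i′} (trans (sym e) e′) = refl
    total : ∀ a → IsCycle (proj₁ a) → ∃ λ b → IsLatin (proj₁ (proj₂ b)) × Break a b
    total ((L , T) , i) (lat , C) = result
      where
      open Strip T
      open Cycle C
      open Flip T C using (rows; columns; flip; flip-row; flip-column; flip-c₀; flip-c₁; flip-latin; flip-cycle)
      S = cycleSymbols L T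
      u = avoid S i
      a = entry L r₀ c₀
      u∉ : u ∉ S
      u∉ = avoid-∉ S i
      open SymbolSwitch {k} a u
      L* = flip L
      lat* = flip-latin L C lat
      symbol∈ : ∀ {x z} → x ∈ rows → z ∈ columns → entry L x z ∈ S
      symbol∈ (here refl) (here refl)                         = here refl
      symbol∈ (here refl) (there (here refl))                 = there (here refl)
      symbol∈ (there (here refl)) (here refl)                 = there (there (here refl))
      symbol∈ (there (here refl)) (there (here refl))         = here (sym s₀)
      symbol∈ (there (there (here refl))) (here refl)         = there (here (sym s₁))
      symbol∈ (there (there (here refl))) (there (here refl)) = there (there (here (sym s₂)))
      u∉* : u ∉ cycleSymbols L* (Flip.flipped T C)
      u∉* (here e)                 = u∉ (here (trans e (flip-c₁ L (here refl))))
      u∉* (there (here e))         = u∉ (there (here (trans e (flip-c₀ L (here refl)))))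
      u∉* (there (there (here e))) = u∉ (there (there (here (trans e (flip-c₁ L (there (here refl)))))))
      result : ∃ λ b → IsLatin (proj₁ (proj₂ b)) × Break ((L , T) , i) b
      result with separation₂ (locate-inj (entry L) lat a) (locate-inj (entry L) lat u) r₀≢r₁
      ... | inj₁ sep = let M , latM , B = broken {L} {T} lat refl u∉ sep in (false , M , _) , latM , direct refl B
      ... | inj₂ sep =
        let M , latM , B = broken {L*} {Flip.flipped T C} lat* (flip-c₁ L (here refl)) u∉* sep*
        in (true , M , _) , latM , flipped C refl B
        where
        -- Only the positions in `r₀` and `r₁` change. In `r₂` the two cells of the pattern carry
        -- the other two symbols, so `a` lies outside the flipped block.
        at-a : ∀ x → entry L* x (locate (entry L) lat a (swap r₀ r₁ x)) ≡ a
        at-a x with x ≟ r₀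
        ... | yes refl = trans (cong (entry L* x) (sym (locate-unique (entry L) lat (sym s₀)))) (flip-c₁ L (here refl))
        ... | no x≢r₀ with x ≟ r₁
        ...   | yes refl = trans (cong (entry L* x) (sym (locate-unique (entry L) lat refl)))
                            (trans (flip-c₀ L (there (here refl))) (sym s₀))
        ...   | no x≢r₁ with x ∈? rows
        ...     | no x∉ = trans (flip-row L x∉) (at-locate (entry L) lat a x)
        ...     | yes (here e)                 = contradiction e x≢r₀
        ...     | yes (there (here e))         = contradiction e x≢r₁
        ...     | yes (there (there (here refl))) = trans (flip-column L off) (at-locate (entry L) lat a x)
          where
          hit : ∀ {z} → locate (entry L) lat a x ≡ z → entry L x z ≡ a
          hit refl = at-locate (entry L) lat a x
          off : locate (entry L) lat a x ∉ columns
          off (here e)         = c₀≢c₁ (sym (proj₁ lat r₀ _ _ (trans s₁ (hit e))))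
          off (there (here e)) = c₀≢c₁ (proj₁ lat r₁ _ _ (trans s₂ (trans (hit e) s₀)))
        -- `u` is none of the symbols of the pattern, so it never lies in the flipped block.
        at-u : ∀ x → entry L* x (locate (entry L) lat u x) ≡ u
        at-u x with x ∈? rows
        ... | no  x∉ = trans (flip-row L x∉) (at-locate (entry L) lat u x)
        ... | yes x∈ = trans (flip-column L λ z∈ → u∉ (subst (_∈ S) (at-locate (entry L) lat u x) (symbol∈ x∈ z∈)))
                         (at-locate (entry L) lat u x)
        sep* : Separation (locate (entry L*) lat* a) (locate (entry L*) lat* u) (r₀ ∷ r₁ ∷ []) r₀
        sep* = Separation-resp (λ x → locate-unique (entry L*) lat* (at-a x)) (λ x → locate-unique (entry L*) lat* (at-u x))
                 (sep (λ x → locate (entry L) lat a (swap r₀ r₁ x)) λ _ → refl)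

-- Labelling the subsquares

record Enumeration {n} (p : Subset n) (m : ℕ) : Set where
  field
    at        : Fin m → Fin n
    injective : Inj at
    at∈       : ∀ i → at i Subset.∈ p
    index     : ∀ {x} → x Subset.∈ p → ∃ λ i → at i ≡ x

enumeration : ∀ {n} (p : Subset n) {m} → ∣ p ∣ ≡ m → Enumeration p m
enumeration Vec.[]            refl = record { at = λ () ; injective = λ { {()} } ; at∈ = λ () ; index = λ () }
enumeration (Subset.outside Vec.∷ p) refl = record
  { at = suc ∘ at ; injective = injective ∘ Fin.suc-injective ; at∈ = Vec.there ∘ at∈
  ; index = λ { (Vec.there x∈) → let i , e = index x∈ in i , cong suc e } }
  where open Enumeration (enumeration p refl)
enumeration (Subset.inside Vec.∷ p) refl = record { at = at′ ; injective = inj′ ; at∈ = in′ ; index = index′ }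
  where
  open Enumeration (enumeration p refl)
  at′ : Fin (suc ∣ p ∣) → Fin _
  at′ zero    = zero
  at′ (suc i) = suc (at i)
  inj′ : Inj at′
  inj′ {zero}  {zero}  _ = refl
  inj′ {suc i} {suc j} e = cong suc (injective (Fin.suc-injective e))
  in′ : ∀ i → at′ i Subset.∈ Subset.inside Vec.∷ p
  in′ zero    = Vec.here
  in′ (suc i) = Vec.there (at∈ i)
  index′ : ∀ {x} → x Subset.∈ Subset.inside Vec.∷ p → ∃ λ i → at′ i ≡ x
  index′ Vec.here       = zero , refl
  index′ (Vec.there x∈) = let i , e = index x∈ in suc i , cong suc e

exhausts : ∀ {n m} {p : Subset n} → ∣ p ∣ ≡ m → (s : Fin m → Fin n) → Inj s → (∀ i → s i Subset.∈ p) →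
           ∀ {x} → x Subset.∈ p → ∃ λ i → x ≡ s i
exhausts {p = p} size s s-inj s∈ x∈ =
  let j , e = index x∈ ; i , f = injective⇒surjective position-inj j in
  i , trans (sym e) (trans (cong at (sym f)) (proj₂ (index (s∈ i))))
  where
  open Enumeration (enumeration p size)
  position : _ → _
  position i = proj₁ (index (s∈ i))
  position-inj : Inj position
  position-inj {i} {j} e = s-inj (trans (sym (proj₂ (index (s∈ i)))) (trans (cong at e) (proj₂ (index (s∈ j)))))

entry∈symbols : ∀ {k n} (L : Matrix k n) {R C i j} → i Subset.∈ R → j Subset.∈ C → entry L i j Subset.∈ symbols L R C
entry∈symbols L {R} {C} {i} {j} i∈ j∈ = lookup⇒[]= _ _ (trans (lookup∘tabulate (λ s → does (occursIn? L R C s)) (entry L i j))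
  (dec-true (occursIn? L R C (entry L i j)) (i , j , i∈ , j∈ , refl)))

-- Cyclic successor and predecessor. A pair `(i , b)` codes one of the six orders of three elements:
-- `i`, `step b i`, `step (not b) i`.
step : Bool → Fin 3 → Fin 3
step true  zero             = suc zero
step true  (suc zero)       = suc (suc zero)
step true  (suc (suc zero)) = zero
step false zero             = suc (suc zero)
step false (suc zero)       = zero
step false (suc (suc zero)) = suc zero

step-cover : ∀ b i m → m ≡ i ⊎ m ≡ step b i ⊎ m ≡ step (not b) i
step-cover true  = toWitness {a? = Fin.all? λ i → Fin.all? λ m → (m ≟ i) ⊎-dec (m ≟ step true i) ⊎-dec (m ≟ step false i)} _
step-cover false = toWitness {a? = Fin.all? λ i → Fin.all? λ m → (m ≟ i) ⊎-dec (m ≟ step false i) ⊎-dec (m ≟ step true i)} _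

step-moves : ∀ b i → i ≢ step b i
step-moves true  = toWitness {a? = Fin.all? λ i → ¬? (i ≟ step true i)} _
step-moves false = toWitness {a? = Fin.all? λ i → ¬? (i ≟ step false i)} _

step-differs : ∀ b i → step b i ≢ step (not b) i
step-differs true  = toWitness {a? = Fin.all? λ i → ¬? (step true i ≟ step false i)} _
step-differs false = toWitness {a? = Fin.all? λ i → ¬? (step false i ≟ step true i)} _

RowSymbols : ∀ {k n} → Array k n → Frame k n → Set
RowSymbols f F = ∀ {x z} → x ∈ rows → z ∈ columns → f x z ≡ f r₀ c₀ ⊎ f x z ≡ f r₀ c₁ ⊎ f x z ≡ f r₀ c₂
  where open Frame F

module _ {k n : ℕ} (f : Array k n) (lat : Latin f) where

  private
    row : ∀ {x z z′} → z ≢ z′ → ∀ {s} → f x z′ ≡ s → f x z ≢ s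
    row z≢ e e′ = z≢ (proj₁ lat _ _ _ (trans e′ (sym e)))
    col : ∀ {z x x′} → x ≢ x′ → ∀ {s} → f x′ z ≡ s → f x z ≢ s
    col x≢ e e′ = x≢ (proj₂ lat _ _ _ (trans e′ (sym e)))

  module _ (F : Frame k n) (D : Frame.Distinct F) (known : RowSymbols f F) where
    open Frame F
    open Distinct D

    private
      z₀ : c₀ ∈ columns
      z₀ = here refl
      z₁ : c₁ ∈ columns
      z₁ = there (here refl)
      z₂ : c₂ ∈ columns
      z₂ = there (there (here refl))
      is-s₀ : ∀ {x z} → x ∈ rows → z ∈ columns → f x z ≢ f r₀ c₁ → f x z ≢ f r₀ c₂ → f x z ≡ f r₀ c₀
      is-s₀ x∈ z∈ a b with known x∈ z∈
      ... | inj₁ e        = e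
      ... | inj₂ (inj₁ e) = contradiction e a
      ... | inj₂ (inj₂ e) = contradiction e b
      is-s₁ : ∀ {x z} → x ∈ rows → z ∈ columns → f x z ≢ f r₀ c₀ → f x z ≢ f r₀ c₂ → f x z ≡ f r₀ c₁
      is-s₁ x∈ z∈ a b with known x∈ z∈
      ... | inj₁ e        = contradiction e a
      ... | inj₂ (inj₁ e) = e
      ... | inj₂ (inj₂ e) = contradiction e b
      is-s₂ : ∀ {x z} → x ∈ rows → z ∈ columns → f x z ≢ f r₀ c₀ → f x z ≢ f r₀ c₁ → f x z ≡ f r₀ c₂
      is-s₂ x∈ z∈ a b with known x∈ z∈
      ... | inj₁ e        = contradiction e a
      ... | inj₂ (inj₁ e) = contradiction e b
      ... | inj₂ (inj₂ e) = e

    -- With this cell given, the other five follow one by one: at each of them two of the three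
    -- symbols are excluded by its row or column.
    complete : f r₁ c₀ ≡ f r₀ c₂ → Square f
    complete e₁₀ = record
      { distinct = D
      ; s₀₁ = sym e₁₁ ; s₀₂ = trans e₁₁ (sym e₂₂)
      ; s₁₁ = sym e₁₂ ; s₁₂ = trans e₁₂ (sym e₂₀)
      ; s₂₁ = sym e₁₀ ; s₂₂ = trans e₁₀ (sym e₂₁) }
      where
      e₁₁ = is-s₀ r₁∈ z₁ (col (≢-sym r₀≢r₁) refl) (row (≢-sym c₀≢c₁) e₁₀)
      e₁₂ = is-s₁ r₁∈ z₂ (row (≢-sym c₁≢c₂) e₁₁) (col (≢-sym r₀≢r₁) refl)
      e₂₀ = is-s₁ r₂∈ z₀ (col (≢-sym r₀≢r₂) refl) (col (≢-sym r₁≢r₂) e₁₀)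
      e₂₁ = is-s₂ r₂∈ z₁ (col (≢-sym r₁≢r₂) e₁₁) (col (≢-sym r₀≢r₂) refl)
      e₂₂ = is-s₀ r₂∈ z₂ (col (≢-sym r₁≢r₂) e₁₂) (col (≢-sym r₀≢r₂) refl)

    -- The two outcomes are the two orientations of a Latin square of order 3; the second becomes
    -- the first when `c₀` and `c₁` exchange names.
    corner : f r₁ c₀ ≡ f r₀ c₂ ⊎ f r₁ c₁ ≡ f r₀ c₂
    corner with known r₁∈ z₀
    ... | inj₁ e        = contradiction e (col (≢-sym r₀≢r₁) refl)
    ... | inj₂ (inj₂ e) = inj₁ e
    ... | inj₂ (inj₁ e) = inj₂ (is-s₂ r₁∈ z₁
            (row c₁≢c₂ (is-s₀ r₁∈ z₂ (row (≢-sym c₀≢c₂) e) (col (≢-sym r₀≢r₁) refl)))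
            (col (≢-sym r₀≢r₁) refl))

IsSubsquareOf : ∀ {k n} → Matrix k n × (Subset k × Subset n) → Set
IsSubsquareOf (L , RC) = IsLatin L × IsSubsquare 3 L RC

module _ {k n : ℕ} where

  -- The order of the rows and the choice of `c₂` are free, which gives 6 · 3 = 18 labellings. The
  -- order `b′` of the other two columns is dictated by the square, so it is not part of the source.
  data Framed : (Matrix k n × (Subset k × Subset n)) × (Fin 3 × Bool × Fin 3) → Matrix k n × Frame k n → Set where
    framed : ∀ {L R C i b j} (eR : ∣ R ∣ ≡ 3) (eC : ∣ C ∣ ≡ 3) b′
             (let open Enumeration (enumeration R eR) using () renaming (at to r))
             (let open Enumeration (enumeration C eC) using () renaming (at to c)) → ∀ {F} →
             F ≡ frame (r i) (r (step b i)) (r (step (not b) i)) (c (step b′ j)) (c (step (not b′) j)) (c j) →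
             Framed ((L , (R , C)) , (i , b , j)) (L , F)

  subsquare↪square : (λ (x : (Matrix k n × (Subset k × Subset n)) × (Fin 3 × Bool × Fin 3)) → IsSubsquareOf (proj₁ x)) ↪ IsSquare
  subsquare↪square = record { _↦_ = Framed ; total = total ; injective = λ _ _ _ → injective }
    where
    covered : ∀ {m} {p q : Subset m} (eq : ∣ p ∣ ≡ 3) (let open Enumeration (enumeration p eq)) b i →
              at i Subset.∈ q → at (step b i) Subset.∈ q → at (step (not b) i) Subset.∈ q → p Subset.⊆ q
    covered {p = p} eq b i u v w x∈ with Enumeration.index (enumeration p eq) x∈
    ... | m , refl with step-cover b i m
    ...   | inj₁ refl        = u
    ...   | inj₂ (inj₁ refl) = v
    ...   | inj₂ (inj₂ refl) = w
    same-set : ∀ {m} {p q : Subset m} (ep : ∣ p ∣ ≡ 3) (eq : ∣ q ∣ ≡ 3)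
               (let at = Enumeration.at (enumeration p ep) ; at′ = Enumeration.at (enumeration q eq)) → ∀ b i b′ i′ →
               at i ≡ at′ i′ → at (step b i) ≡ at′ (step b′ i′) → at (step (not b) i) ≡ at′ (step (not b′) i′) → p ≡ q
    same-set {p = p} {q} ep eq b i b′ i′ u v w = ⊆-antisym
      (covered ep b i (subst (Subset._∈ q) (sym u) (Q.at∈ i′)) (subst (Subset._∈ q) (sym v) (Q.at∈ _)) (subst (Subset._∈ q) (sym w) (Q.at∈ _)))
      (covered eq b′ i′ (subst (Subset._∈ p) u (P.at∈ i)) (subst (Subset._∈ p) v (P.at∈ _)) (subst (Subset._∈ p) w (P.at∈ _)))
      where
      module P = Enumeration (enumeration p ep)
      module Q = Enumeration (enumeration q eq)
    same-bit : ∀ {m} {p : Subset m} (ep : ∣ p ∣ ≡ 3) (let at = Enumeration.at (enumeration p ep)) → ∀ b b′ i →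
               at (step b i) ≡ at (step b′ i) → b ≡ b′
    same-bit ep true  true  i e = refl
    same-bit ep false false i e = refl
    same-bit {p = p} ep true  false i e = contradiction (Enumeration.injective (enumeration p ep) e) (step-differs true i)
    same-bit {p = p} ep false true  i e = contradiction (Enumeration.injective (enumeration p ep) e) (step-differs false i)
    injective : ∀ {a a′ y} → Framed a y → Framed a′ y → a ≡ a′
    injective (framed {R = R} {C} {i} {b} {j} eR eC c refl) (framed {R = R′} {C′} {i′} {b′} {j′} eR′ eC′ c′ eF)
      with refl ← same-set {p = R} {R′} eR eR′ b i b′ i′ (cong Frame.r₀ eF) (cong Frame.r₁ eF) (cong Frame.r₂ eF)
         | refl ← same-set {p = C} {C′} eC eC′ c j c′ j′ (cong Frame.c₂ eF) (cong Frame.c₀ eF) (cong Frame.c₁ eF)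
      -- The enumerations take the size proofs as arguments, so these are identified before indices
      -- are compared.
      with refl ← ℕ.≡-irrelevant eR eR′ | refl ← ℕ.≡-irrelevant eC eC′
      with refl ← Enumeration.injective (enumeration R eR) {i} {i′} (cong Frame.r₀ eF)
         | refl ← Enumeration.injective (enumeration C eC) {j} {j′} (cong Frame.c₂ eF)
      with refl ← same-bit {p = R} eR b b′ i (cong Frame.r₁ eF) = refl
    total : ∀ a → IsSubsquareOf (proj₁ a) → ∃ λ y → IsSquare y × Framed a y
    total ((L , (R , C)) , (i , b , j)) (lat , (eR , eC , eS)) = result
      where
      module R = Enumeration (enumeration R eR)
      module C = Enumeration (enumeration C eC)
      F : Bool → Frame k n
      F b′ = frame (R.at i) (R.at (step b i)) (R.at (step (not b) i)) (C.at (step b′ j)) (C.at (step (not b′) j)) (C.at j)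
      D : ∀ b′ → Frame.Distinct (F b′)
      D b′ = record
        { r₀≢r₁ = step-moves b i ∘ R.injective ; r₀≢r₂ = step-moves (not b) i ∘ R.injective
        ; r₁≢r₂ = step-differs b i ∘ R.injective ; c₀≢c₁ = step-differs b′ j ∘ C.injective
        ; c₀≢c₂ = ≢-sym (step-moves b′ j) ∘ C.injective ; c₁≢c₂ = ≢-sym (step-moves (not b′) j) ∘ C.injective }
      row∈ : ∀ {b′ x} → x ∈ Frame.rows (F b′) → x Subset.∈ R
      row∈ (here refl)                         = R.at∈ _
      row∈ (there (here refl))             = R.at∈ _
      row∈ (there (there (here refl))) = R.at∈ _
      column∈ : ∀ {b′ z} → z ∈ Frame.columns (F b′) → z Subset.∈ C
      column∈ (here refl)                         = C.at∈ _
      column∈ (there (here refl))             = C.at∈ _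
      column∈ (there (there (here refl))) = C.at∈ _
      -- The first row already shows three distinct symbols, and the subsquare has no more.
      known : ∀ b′ → RowSymbols (entry L) (F b′)
      known b′ {x} {z} x∈ z∈ = classify (exhausts eS (λ m → entry L (R.at i) (C.at m)) (λ e → C.injective (proj₁ lat _ _ _ e))
                           (λ m → entry∈symbols L (R.at∈ i) (C.at∈ m)) (entry∈symbols L (row∈ {b′} x∈) (column∈ {b′} z∈)))
        where
        open Frame (F b′)
        classify : (∃ λ m → entry L x z ≡ entry L (R.at i) (C.at m)) →
                   entry L x z ≡ entry L r₀ c₀ ⊎ entry L x z ≡ entry L r₀ c₁ ⊎ entry L x z ≡ entry L r₀ c₂
        classify (m , e) with step-cover b′ j m
        ... | inj₁ refl        = inj₂ (inj₂ e)
        ... | inj₂ (inj₁ refl) = inj₁ e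
        ... | inj₂ (inj₂ refl) = inj₂ (inj₁ e)
      finish : ∀ b′ (let open Frame (F b′)) → entry L r₁ c₀ ≡ entry L r₀ c₂ →
               ∃ λ y → IsSquare y × Framed ((L , (R , C)) , (i , b , j)) y
      finish b′ e = (L , F b′) , (lat , complete (entry L) lat (F b′) (D b′) (known b′) e) , framed eR eC b′ refl
      result : ∃ λ y → IsSquare y × Framed ((L , (R , C)) , (i , b , j)) y
      result = [ finish true , finish false ]′ (corner (entry L) lat (F true) (D true) (known true))

-- Counting

vectors-complete : ∀ {A : Set} {xs : List A} {n} (v : Vec A n) → (∀ i → lookup v i ∈ xs) → v ∈ vectors xs n
vectors-complete Vec.[]      _ = here refl
vectors-complete (x Vec.∷ v) p = ∈-cartesianProductWith⁺ Vec._∷_ (p zero) (vectors-complete v (p ∘ suc))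

vectors-unique : ∀ {A : Set} {xs : List A} → Unique xs → ∀ n → Unique (vectors xs n)
vectors-unique u zero    = All.[] AllPairs.∷ AllPairs.[]
vectors-unique u (suc n) = cartesianProductWith⁺ Vec._∷_ ∷-injective u (vectors-unique u n)

latin⇒∈ : ∀ {k n} {L : Matrix k n} → IsLatin L → L ∈ latinRectangles k n
latin⇒∈ {L = L} lat = ∈-filter⁺ isLatin?
  (vectors-complete L λ i → vectors-complete (lookup L i) λ j → ∈-allFin _) lat

∈⇒latin : ∀ {k n} {L : Matrix k n} → L ∈ latinRectangles k n → IsLatin L
∈⇒latin {k} {n} L∈ = proj₂ (∈-filter⁻ isLatin? {xs = vectors (vectors (allFin n) n) k} L∈)

length-cartesianProductWith : ∀ {A B C : Set} (f : A → B → C) xs ys →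
                              length (cartesianProductWith f xs ys) ≡ length xs ℕ.* length ys
length-cartesianProductWith f []       ys = refl
length-cartesianProductWith f (x ∷ xs) ys = trans (length-++ (map (f x) ys))
  (cong₂ ℕ._+_ (length-map (f x) ys) (length-cartesianProductWith f xs ys))

length-vectors : ∀ {A : Set} (xs : List A) n → length (vectors xs n) ≡ length xs ℕ.^ n
length-vectors xs zero    = refl
length-vectors xs (suc n) = trans (length-cartesianProductWith Vec._∷_ xs (vectors xs n)) (cong (length xs ℕ.*_) (length-vectors xs n))

module _ {A B : Set} {P : A → Set} {Q : B → Set} (F : P ↪ Q) where
  open _↪_ F

  -- `total` selects one image for each element, and `injective` makes the selected images distinct.
  ↪⇒length-≤ : ∀ {xs ys} → Unique xs → (∀ {x} → x ∈ xs → P x) → (∀ {y} → Q y → y ∈ ys) → length xs ℕ.≤ length ys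
  ↪⇒length-≤ {xs} {ys} uniq P∈ ∈Q =
    let zs , len , u , from = images uniq P∈ in
    subst (ℕ._≤ length ys) len (unique-⊆⇒length-≤ u λ z∈ → ∈Q (proj₁ (from z∈)))
    where
    images : ∀ {xs} → Unique xs → (∀ {x} → x ∈ xs → P x) →
             ∃ λ zs → length zs ≡ length xs × Unique zs × (∀ {z} → z ∈ zs → Q z × ∃ λ x → x ∈ xs × x ↦ z)
    images AllPairs.[] _ = [] , refl , AllPairs.[] , λ ()
    images {x ∷ xs} (x∉ AllPairs.∷ u) P∈ =
      let zs , len , uz , from = images u (P∈ ∘ there)
          y , q , xy = total x (P∈ (here refl))
      in y ∷ zs , cong suc len
       , All.tabulate (λ { z∈ refl → let _ , x′ , x′∈ , x′y = from z∈ in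
           All.lookup x∉ x′∈ (injective (P∈ (here refl)) (P∈ (there x′∈)) q xy x′y) }) AllPairs.∷ uz
       , λ { (here refl) → q , x , here refl , xy
           ; (there z∈) → let q′ , x′ , x′∈ , x′z = from z∈ in q′ , x′ , there x′∈ , x′z }

-- Composition that lays aside the code `D` of the first map and lets the second map draw a fresh
-- choice from `E`.
extend : ∀ {A B C D D′ E : Set} {P : A → Set} {Q : B → Set} {R : C → Set} →
         P ↪ (λ (y : D × B) → Q (proj₂ y)) → (λ (x : B × E) → Q (proj₁ x)) ↪ (λ (y : D′ × C) → R (proj₂ y)) →
         (λ (x : A × E) → P (proj₁ x)) ↪ (λ (y : (D × D′) × C) → R (proj₂ y))
extend {Q = Q} F G = record
  { _↦_ = λ (a , e) ((d , d′) , c) → ∃ λ b → Q b × F._↦_ a (d , b) × G._↦_ (b , e) (d′ , c)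
  ; total = λ (a , e) p → let (d , b) , q , f = F.total a p ; (d′ , c) , r , g = G.total (b , e) q in
      ((d , d′) , c) , r , (b , q , f , g)
  ; injective = λ { p p′ r (b , q , f , g) (b′ , q′ , f′ , g′) → merge p p′ q f f′ (G.injective q q′ r g g′) } }
  where
  module F = _↪_ F
  module G = _↪_ G
  merge : ∀ {a a′ b b′ d e e′} → _ → _ → Q b → F._↦_ a (d , b) → F._↦_ a′ (d , b′) → (b , e) ≡ (b′ , e′) → (a , e) ≡ (a′ , e′)
  merge p p′ q f f′ refl = cong (_, _) (F.injective p p′ q f f′)

subsquare↪seed : ∀ {k n} →
  (λ (x : ((((Matrix k n × (Subset k × Subset n)) × (Fin 3 × Bool × Fin 3)) × Fin (n ∸ 3)) × Fin (n ∸ 4)) × Fin (n ∸ 3)) →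
    IsSubsquareOf (proj₁ (proj₁ (proj₁ (proj₁ x))))) ↪
  (λ (y : ((Fin 3 × Bool) × Bool) × (Matrix k n × (Fin k × Fin n × Fin n))) → IsLatin (proj₁ (proj₂ y)))
subsquare↪seed = extend (extend ((subsquare↪square ⊗ʳ _) ⟫ square↪holed) holed↪cycle) cycle↪seed

module _ {A B : Set} {P : A × B → Set} (P? : ∀ x → Dec (P x)) where

  length-filter-cartesianProduct : ∀ xs ys → length (filter P? (cartesianProduct xs ys))
                                 ≡ sum (map (λ x → length (filter (λ y → P? (x , y)) ys)) xs)
  length-filter-cartesianProduct []       ys = refl
  length-filter-cartesianProduct (x ∷ xs) ys =
    trans (cong length (filter-++ P? (map (x ,_) ys) (cartesianProduct xs ys)))
    (trans (length-++ (filter P? (map (x ,_) ys)))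
    (cong₂ ℕ._+_ (slice ys) (length-filter-cartesianProduct xs ys)))
    where
    slice : ∀ ys → length (filter P? (map (x ,_) ys)) ≡ length (filter (λ y → P? (x , y)) ys)
    slice []       = refl
    slice (y ∷ ys) with does (P? (x , y))
    ... | true  = cong suc (slice ys)
    ... | false = slice ys

#total : ℕ → ℕ → ℕ
#total k n = sum (map (#subsquares 3) (latinRectangles k n))

#latin : ℕ → ℕ → ℕ
#latin k n = length (latinRectangles k n)

module _ (k n : ℕ) where
  private
    bools : List Bool
    bools = true ∷ false ∷ []

    bools-complete : ∀ b → b ∈ bools
    bools-complete true  = here refl
    bools-complete false = there (here refl)

    bools-unique : Unique bools
    bools-unique = ((λ ()) All.∷ All.[]) AllPairs.∷ All.[] AllPairs.∷ AllPairs.[]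

    length-allFin : ∀ m → length (allFin m) ≡ m
    length-allFin m = length-tabulate (λ (x : Fin m) → x)

    length-× : ∀ {A B : Set} (xs : List A) (ys : List B) {a b} → length xs ≡ a → length ys ≡ b →
               length (cartesianProduct xs ys) ≡ a ℕ.* b
    length-× xs ys refl refl = length-cartesianProductWith _,_ xs ys

    isSub? : (x : Matrix k n × (Subset k × Subset n)) → Dec (IsSubsquare 3 (proj₁ x) (proj₂ x))
    isSub? (L , RC) = isSubsquare? 3 L RC

    places : List (Subset k × Subset n)
    places = cartesianProduct (subsets k) (subsets n)

    subsquares : List (Matrix k n × (Subset k × Subset n))
    subsquares = filter isSub? (cartesianProduct (latinRectangles k n) places)

    subsets-unique : ∀ m → Unique (subsets m)
    subsets-unique = vectors-unique (((λ ()) All.∷ All.[]) AllPairs.∷ All.[] AllPairs.∷ AllPairs.[])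

    orders : List (Fin 3 × Bool × Fin 3)
    orders = cartesianProduct (allFin 3) (cartesianProduct bools (allFin 3))

    lefts₁ : List _
    lefts₁ = cartesianProduct subsquares orders
    lefts₂ : List _
    lefts₂ = cartesianProduct lefts₁ (allFin (n ∸ 3))
    lefts₃ : List _
    lefts₃ = cartesianProduct lefts₂ (allFin (n ∸ 4))
    lefts : List _
    lefts = cartesianProduct lefts₃ (allFin (n ∸ 3))

    codes : List ((Fin 3 × Bool) × Bool)
    codes = cartesianProduct (cartesianProduct (allFin 3) bools) bools
    seeds : List (Fin k × Fin n × Fin n)
    seeds = cartesianProduct (allFin k) (cartesianProduct (allFin n) (allFin n))
    rights : List _
    rights = cartesianProduct codes (cartesianProduct (latinRectangles k n) seeds)

    lefts-unique : Unique lefts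
    lefts-unique = cartesianProduct⁺ (cartesianProduct⁺ (cartesianProduct⁺ (cartesianProduct⁺
      (filter⁺ isSub? (cartesianProduct⁺
        (filter⁺ isLatin? (vectors-unique (vectors-unique (allFin⁺ n) n) k))
        (cartesianProduct⁺ (subsets-unique k) (subsets-unique n))))
      (cartesianProduct⁺ (allFin⁺ 3) (cartesianProduct⁺ bools-unique (allFin⁺ 3))))
      (allFin⁺ _)) (allFin⁺ _)) (allFin⁺ _)

    first : ∀ {A B : Set} (xs : List A) (ys : List B) {x} → x ∈ cartesianProduct xs ys → proj₁ x ∈ xs
    first xs ys {_ , _} = proj₁ ∘ ∈-cartesianProduct⁻ xs ys

    lefts-sound : ∀ {x} → x ∈ lefts → IsSubsquareOf (proj₁ (proj₁ (proj₁ (proj₁ x))))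
    lefts-sound x∈ with ∈-filter⁻ isSub? {xs = cartesianProduct (latinRectangles k n) places}
                          (first subsquares _ (first _ _ (first _ _ (first _ _ x∈))))
    ... | L∈ , sub = ∈⇒latin (first _ _ L∈) , sub

    rights-complete : ∀ {y} → IsLatin (proj₁ (proj₂ y)) → y ∈ rights
    rights-complete lat =
      ∈-cartesianProduct⁺ (∈-cartesianProduct⁺ (∈-cartesianProduct⁺ (∈-allFin _) (bools-complete _)) (bools-complete _))
        (∈-cartesianProduct⁺ (latin⇒∈ lat) (∈-cartesianProduct⁺ (∈-allFin _) (∈-cartesianProduct⁺ (∈-allFin _) (∈-allFin _))))

  count : #total k n ℕ.* 18 ℕ.* (n ∸ 3) ℕ.* (n ∸ 4) ℕ.* (n ∸ 3) ℕ.≤ 12 ℕ.* (#latin k n ℕ.* (k ℕ.* (n ℕ.* n)))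
  count = subst₂ ℕ._≤_ #lefts #rights (↪⇒length-≤ subsquare↪seed lefts-unique lefts-sound rights-complete)
    where
    #subsquares-list : length subsquares ≡ #total k n
    #subsquares-list = length-filter-cartesianProduct isSub? (latinRectangles k n) places
    #lefts : length lefts ≡ #total k n ℕ.* 18 ℕ.* (n ∸ 3) ℕ.* (n ∸ 4) ℕ.* (n ∸ 3)
    #lefts = length-× lefts₃ (allFin (n ∸ 3)) (length-× lefts₂ (allFin (n ∸ 4)) (length-× lefts₁ (allFin (n ∸ 3))
      (length-× subsquares orders #subsquares-list refl)
      (length-allFin (n ∸ 3))) (length-allFin (n ∸ 4))) (length-allFin (n ∸ 3))
    #rights : length rights ≡ 12 ℕ.* (#latin k n ℕ.* (k ℕ.* (n ℕ.* n)))
    #rights = length-× codes (cartesianProduct (latinRectangles k n) seeds) refl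
      (length-× (latinRectangles k n) seeds refl
        (length-× (allFin k) (cartesianProduct (allFin n) (allFin n)) (length-allFin k)
          (length-× (allFin n) (allFin n) (length-allFin n) (length-allFin n))))

  -- For `n` at most 4 both sides of `count` need another companion: its left side vanishes with
  -- `n ∸ 4` and bounds nothing. Here every pair of subsets is allowed to be a subsquare.
  crude : #total k n ℕ.≤ #latin k n ℕ.* (2 ℕ.^ k ℕ.* 2 ℕ.^ n)
  crude = bound (latinRectangles k n)
    where
    #places : length places ≡ 2 ℕ.^ k ℕ.* 2 ℕ.^ n
    #places = length-× (subsets k) (subsets n) (length-vectors _ k) (length-vectors _ n)
    bound : ∀ Ls → sum (map (#subsquares 3) Ls) ℕ.≤ length Ls ℕ.* (2 ℕ.^ k ℕ.* 2 ℕ.^ n)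
    bound []       = z≤n
    bound (L ∷ Ls) = ℕ.+-mono-≤ (ℕ.≤-trans (length-filter (isSubsquare? 3 L) places) (ℕ.≤-reflexive #places)) (bound Ls)

-- Estimates in natural numbers

module _ where
  open import Data.Nat.Base using (_+_; _*_; _≤_; _^_; _∸_)
  open ℕ.≤-Reasoning

  -- For `n = 8 + m` this is n⁴ ≤ (n - 3)²(n - 4)(n + 56), and the difference has nonnegative
  -- coefficients in `m`. As (n - 3)²(n - 4) begins with n³ - 10n², any constant above 10 serves for
  -- large `n`; 56 is ample from 8 on.
  quartic : ∀ m → (8 + m) * (8 + m) * ((8 + m) * (8 + m)) ≤ (5 + m) * (4 + m) * (5 + m) * (8 + m + 56)
  quartic m = ℕ.≤-trans (ℕ.m≤m+n _ (46 * (m * (m * m)) + 577 * (m * m) + 2212 * m + 2304)) (ℕ.≤-reflexive (expand m))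
    where
    expand : ∀ m → (8 + m) * (8 + m) * ((8 + m) * (8 + m)) + (46 * (m * (m * m)) + 577 * (m * m) + 2212 * m + 2304)
                 ≡ (5 + m) * (4 + m) * (5 + m) * (8 + m + 56)
    expand = solve-∀

  -- Turns the relative error 56/n into 56/k, which is no smaller because `k ≤ n`.
  cubic : ∀ k n D .{{_ : NonZero n}} → k ≤ n → n * n * (n * n) ≤ D * (n + 56) → k * (n * (n * n)) ≤ D * (k + 56)
  cubic k n D k≤n h = ℕ.*-cancelˡ-≤ n (begin
    n * (k * (n * (n * n)))   ≡⟨ e₁ n k ⟩
    k * (n * n * (n * n))     ≤⟨ ℕ.*-monoʳ-≤ k h ⟩
    k * (D * (n + 56))        ≡⟨ e₂ k D n ⟩
    D * (k * n) + D * 56 * k  ≤⟨ ℕ.+-monoʳ-≤ (D * (k * n)) (ℕ.*-monoʳ-≤ (D * 56) k≤n) ⟩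
    D * (k * n) + D * 56 * n  ≡⟨ e₃ k D n ⟩
    n * (D * (k + 56))        ∎)
    where
    e₁ : ∀ n k → n * (k * (n * (n * n))) ≡ k * (n * n * (n * n))
    e₁ = solve-∀
    e₂ : ∀ k D n → k * (D * (n + 56)) ≡ D * (k * n) + D * 56 * k
    e₂ = solve-∀
    e₃ : ∀ k D n → D * (k * n) + D * 56 * n ≡ n * (D * (k + 56))
    e₃ = solve-∀

  large : ∀ S N k n a b .{{_ : NonZero (a * b * a)}} → k * (n * (n * n)) ≤ a * b * a * (k + 56) →
          S * 18 * a * b * a ≤ 12 * (N * (k * (n * n))) → S * (3 * n) ≤ 2 * (k + 56) * N
  large S N k n a b k≤ h = ℕ.*-cancelˡ-≤ (a * b * a) (ℕ.*-cancelˡ-≤ 6 (begin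
    6 * (a * b * a * (S * (3 * n)))          ≡⟨ e₁ S n a b ⟩
    n * (S * 18 * a * b * a)                 ≤⟨ ℕ.*-monoʳ-≤ n h ⟩
    n * (12 * (N * (k * (n * n))))           ≡⟨ e₂ n N k ⟩
    12 * N * (k * (n * (n * n)))             ≤⟨ ℕ.*-monoʳ-≤ (12 * N) k≤ ⟩
    12 * N * (a * b * a * (k + 56))          ≡⟨ e₃ N k a b ⟩
    6 * (a * b * a * (2 * (k + 56) * N))     ∎))
    where
    e₁ : ∀ S n a b → 6 * (a * b * a * (S * (3 * n))) ≡ n * (S * 18 * a * b * a)
    e₁ = solve-∀
    e₂ : ∀ n N k → n * (12 * (N * (k * (n * n)))) ≡ 12 * N * (k * (n * (n * n)))
    e₂ = solve-∀
    e₃ : ∀ N k a b → 12 * N * (a * b * a * (k + 56)) ≡ 6 * (a * b * a * (2 * (k + 56) * N))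
    e₃ = solve-∀

  small : ∀ S N P C k n → S ≤ N * P → n ≤ 7 → P * 21 ≤ 2 * C → S * (3 * n) ≤ 2 * (k + C) * N
  small S N P C k n S≤NP n≤7 P≤C = begin
    S * (3 * n)        ≤⟨ ℕ.*-mono-≤ S≤NP (ℕ.*-monoʳ-≤ 3 n≤7) ⟩
    N * P * 21         ≡⟨ e N P 21 ⟩
    P * 21 * N         ≤⟨ ℕ.*-monoˡ-≤ N P≤C ⟩
    2 * C * N          ≤⟨ ℕ.*-monoˡ-≤ N (ℕ.*-monoʳ-≤ 2 (ℕ.m≤n+m C k)) ⟩
    2 * (k + C) * N    ∎
    where
    e : ∀ N P a → N * P * a ≡ P * a * N
    e = solve-∀

  -- For n ≥ 8 the constant 56 would do; this one also absorbs the crude bound for n ≤ 7.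
  slack : ℕ
  slack = 56 + 171976

  bound : ∀ S N k n → k ≤ n → S * 18 * (n ∸ 3) * (n ∸ 4) * (n ∸ 3) ≤ 12 * (N * (k * (n * n))) →
          S ≤ N * (2 ^ k * 2 ^ n) → S * (3 * n) ≤ 2 * (k + slack) * N
  bound S N k n k≤n fine crude with ℕ.≤-<-connex 8 n
  ... | inj₂ (s≤s n≤7) = small S N (2 ^ k * 2 ^ n) slack k n crude n≤7
      -- There are at most 2^14 pairs of subsets, `3 * n` is at most 21, and 2^14 · 21 is exactly
      -- `2 * slack`.
      (ℕ.*-monoˡ-≤ 21 (ℕ.*-mono-≤ (ℕ.^-monoʳ-≤ 2 (ℕ.≤-trans k≤n n≤7)) (ℕ.^-monoʳ-≤ 2 n≤7)))
  ... | inj₁ 8≤n with ℕ.m≤n⇒∃[o]m+o≡n 8≤n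
  ...   | m , refl = ℕ.≤-trans (large S N k n (5 + m) (4 + m) (cubic k n ((5 + m) * (4 + m) * (5 + m)) k≤n (quartic m)) fine)
                       (ℕ.*-monoˡ-≤ N (ℕ.*-monoʳ-≤ 2 (ℕ.+-monoʳ-≤ k (ℕ.m≤m+n 56 171976))))

-- Passage to the rationals

open import Data.Rational.Base using (ℚ; 0ℚ; 1ℚ; _/_; _*_; _+_; _≤_; toℚᵘ)

infix 8 _÷_
_÷_ : ℕ → (d : ℕ) .{{_ : NonZero d}} → ℚᵘ
a ÷ d = + a ℚᵘ./ d

toℚᵘ-/ : ∀ a d .{{_ : NonZero d}} → toℚᵘ (+ a / d) ℚᵘ.≃ a ÷ d
toℚᵘ-/ a (suc d) = ℚ.toℚᵘ-fromℚᵘ (mkℚᵘ (+ a) d)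

÷-* : ∀ a b c d → a ÷ suc b ℚᵘ.* c ÷ suc d ≡ (a ℕ.* c) ÷ (suc b ℕ.* suc d)
÷-* a b c d = cong (ℚᵘ._/ (suc b ℕ.* suc d)) (sym (ℤ.pos-* a c))

÷-+ : ∀ a b c d → a ÷ suc b ℚᵘ.+ c ÷ suc d ≡ (a ℕ.* suc d ℕ.+ c ℕ.* suc b) ÷ (suc b ℕ.* suc d)
÷-+ a b c d = cong (ℚᵘ._/ (suc b ℕ.* suc d)) (sym (trans (ℤ.pos-+ (a ℕ.* suc d) (c ℕ.* suc b))
  (cong₂ ℤ._+_ (ℤ.pos-* a (suc d)) (ℤ.pos-* c (suc b)))))

÷-≤ : ∀ a b c d → a ℕ.* suc d ℕ.≤ c ℕ.* suc b → a ÷ suc b ℚᵘ.≤ c ÷ suc d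
÷-≤ a b c d h = *≤* (subst₂ ℤ._≤_ (ℤ.pos-* a (suc d)) (ℤ.pos-* c (suc b)) (ℤ.+≤+ h))

O[1/k] : ℕ → ℕ → ℕ → ℚ
-- A default value; the claims concern `k ≥ 3`.
O[1/k] C zero    n = 0ℚ
O[1/k] C (suc k) n = (+ C / 1) * (+ 1 / suc k)

O[1/k]-isO : ∀ C → IsO[1/k] (O[1/k] C)
O[1/k]-isO C = + C / 1 , 0 , λ { (suc k) n _ _ _ → ℚ.≤-reflexive (ℚ.0≤p⇒∣p∣≡p (ℚ.nonNegative⁻¹ _
  {{ℚ.nonNeg*nonNeg⇒nonNeg (+ C / 1) {{ℚ.normalize-nonNeg C 1}} (+ 1 / suc k) {{ℚ.normalize-nonNeg 1 (suc k)}}}})) }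

-- In unnormalised rationals the right-hand side is literally one fraction `A ÷ B`, with nothing
-- cancelled, so the claim reduces by cross-multiplication to the hypothesis times `k`.
fraction-bound : ∀ C S N k n .{{_ : NonZero N}} .{{_ : NonZero k}} .{{_ : NonZero n}} →
                 S ℕ.* (3 ℕ.* n) ℕ.≤ 2 ℕ.* (k ℕ.+ C) ℕ.* N →
                 + S / N ≤ (+ 2 / 3) * (+ k / n) * (1ℚ + O[1/k] C k n)
fraction-bound C S (suc N) (suc k) (suc n) h = ℚ.toℚᵘ-cancel-≤ (begin
  toℚᵘ (+ S / suc N)                                   ≃⟨ toℚᵘ-/ S (suc N) ⟩
  S ÷ suc N                                            ≤⟨ ÷-≤ S N _ _ (scaled S C (suc N) (suc k) (suc n) h) ⟩
  A ÷ B                                                ≡⟨ split ⟨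
  2 ÷ 3 ℚᵘ.* suc k ÷ suc n ℚᵘ.* (1 ÷ 1 ℚᵘ.+ C ÷ 1 ℚᵘ.* 1 ÷ suc k)
    ≃⟨ ℚᵘ.*-cong (ℚᵘ.*-cong (toℚᵘ-/ 2 3) (toℚᵘ-/ (suc k) (suc n)))
         (ℚᵘ.+-congʳ (1 ÷ 1) (ℚᵘ.≃-trans (ℚ.toℚᵘ-homo-* (+ C / 1) (+ 1 / suc k)) (ℚᵘ.*-cong (toℚᵘ-/ C 1) (toℚᵘ-/ 1 (suc k))))) ⟨
  toℚᵘ (+ 2 / 3) ℚᵘ.* toℚᵘ (+ suc k / suc n) ℚᵘ.* (toℚᵘ 1ℚ ℚᵘ.+ toℚᵘ (O[1/k] C (suc k) (suc n)))
    ≃⟨ ℚᵘ.*-cong (ℚ.toℚᵘ-homo-* (+ 2 / 3) (+ suc k / suc n)) (ℚ.toℚᵘ-homo-+ 1ℚ (O[1/k] C (suc k) (suc n))) ⟨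
  toℚᵘ ((+ 2 / 3) * (+ suc k / suc n)) ℚᵘ.* toℚᵘ (1ℚ + O[1/k] C (suc k) (suc n))
    ≃⟨ ℚ.toℚᵘ-homo-* ((+ 2 / 3) * (+ suc k / suc n)) (1ℚ + O[1/k] C (suc k) (suc n)) ⟨
  toℚᵘ ((+ 2 / 3) * (+ suc k / suc n) * (1ℚ + O[1/k] C (suc k) (suc n))) ∎)
  where
  open ℚᵘ.≤-Reasoning
  A = 2 ℕ.* suc k ℕ.* (1 ℕ.* (1 ℕ.* suc k) ℕ.+ C ℕ.* 1 ℕ.* 1)
  B = 3 ℕ.* suc n ℕ.* (1 ℕ.* (1 ℕ.* suc k))
  split : 2 ÷ 3 ℚᵘ.* suc k ÷ suc n ℚᵘ.* (1 ÷ 1 ℚᵘ.+ C ÷ 1 ℚᵘ.* 1 ÷ suc k) ≡ A ÷ B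
  split = trans (cong₂ ℚᵘ._*_ (÷-* 2 2 (suc k) n) (trans (cong (1 ÷ 1 ℚᵘ.+_) (÷-* C 0 1 k)) (÷-+ 1 0 (C ℕ.* 1) (k ℕ.+ 0))))
            (÷-* (2 ℕ.* suc k) (n ℕ.+ 2 ℕ.* suc n) (1 ℕ.* (1 ℕ.* suc k) ℕ.+ C ℕ.* 1 ℕ.* 1) (k ℕ.+ 0 ℕ.+ 0))
  scaled : ∀ S C N k n → S ℕ.* (3 ℕ.* n) ℕ.≤ 2 ℕ.* (k ℕ.+ C) ℕ.* N →
           S ℕ.* (3 ℕ.* n ℕ.* (1 ℕ.* (1 ℕ.* k))) ℕ.≤ 2 ℕ.* k ℕ.* (1 ℕ.* (1 ℕ.* k) ℕ.+ C ℕ.* 1 ℕ.* 1) ℕ.* N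
  scaled S C N k n h = subst₂ ℕ._≤_ (e₁ S n k) (e₂ k C N) (ℕ.*-monoˡ-≤ k h)
    where
    e₁ : ∀ S n k → S ℕ.* (3 ℕ.* n) ℕ.* k ≡ S ℕ.* (3 ℕ.* n ℕ.* (1 ℕ.* (1 ℕ.* k)))
    e₁ = solve-∀
    e₂ : ∀ k C N → 2 ℕ.* (k ℕ.+ C) ℕ.* N ℕ.* k ≡ 2 ℕ.* k ℕ.* (1 ℕ.* (1 ℕ.* k) ℕ.+ C ℕ.* 1 ℕ.* 1) ℕ.* N
    e₂ = solve-∀

theorem4p1 : ∃ λ (ε : ℕ → ℕ → ℚ) → IsO[1/k] ε ×
    (∀ k n .{{_ : NonZero n}} → 3 ℕ.≤ k → (k≤n : k ℕ.≤ n) →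
    𝔼 3 k n k≤n ≤ (+ 2 / 3) * (+ k / n) * (1ℚ + ε k n))
theorem4p1 = O[1/k] slack , O[1/k]-isO slack , λ k n 3≤k k≤n →
  fraction-bound slack (#total k n) (#latin k n) k n
    {{latinRectangles-nonEmpty k≤n}} {{ℕ.>-nonZero (ℕ.≤-trans (s≤s z≤n) 3≤k)}} (bound (#total k n) (#latin k n) k n k≤n (count k n) (crude k n))
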